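{- Let $K$ and $S$ be Kleene algebras that are Morita-equivalent via a Kleene $(K,S)$-bimodule $M$ and a Kleene $(S,K)$-bimodule $N$, i.e. $M\otimes_S N\cong {}_KK_K$ and $N\otimes_K M\cong {}_SS_S$ as bimodules. Then the functors $P\mapsto N\otimes_K P$, from left Kleene $K$-modules to left Kleene $S$-modules, and $Q\mapsto M\otimes_S Q$, from left Kleene $S$-modules to left Kleene $K$-modules, constitute an equivalence of categories. Moreover, the category of right Kleene $K$-modules is equivalent to the category of right Kleene $S$-modules, and the category of Kleene $(K,S)$-bimodules is equivalent to the category of Kleene $(S,K)$-bimodules.
   Context: A semiring $\langle S,+,\cdot,0,1\rangle$ is unital: $\langle S,+,0\rangle$ is a commutative monoid, $\langle S,\cdot,1\rangle$ is a monoid, $s0=0s=0$ for all $s$, and multiplication distributes over addition on both sides. A left module over a semiring $S$ is a commutative monoid $\langle M,+,0\rangle$ with a map $S\times M\to M$ satisfying $s(m+n)=sm+sn$, $(s+t)m=sm+tm$, $s(tm)=(st)m$, $1m=m$, $0m=0$; right modules are defined symmetrically. An $(S,T)$-bimodule is a left $S$-module and right $T$-module on the same commutative monoid with $s(mt)=(sm)t$. Homomorphisms are maps preserving addition and the scalar action(s); these are the morphisms of all module categories considered. A Kleene algebra is an additively idempotent semiring $K$ ($x+x=x$), ordered by $x\le y\iff x+y=y$, with a unary operation $*$ such that for all $x,y,z$: $1+xx^*=1+x^*x=x^*$; if $x+yz\le z$ then $y^*x\le z$; if $x+zy\le z$ then $xy^*\le z$. A left Kleene module over $K$ is a left module $M$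 over the semiring reduct of $K$ such that $am\le m\Rightarrow a^*m\le m$ for all $a\in K$, $m\in M$ (where $x\le y\iff x+y=y$); a right Kleene module is defined symmetrically ($ma\le m\Rightarrow ma^*\le m$). A Kleene $(K,L)$-bimodule is a semiring $(K,L)$-bimodule that is both a left Kleene module over $K$ and a right Kleene module over $L$. Tensor product: for an $(A,B)$-bimodule $X$ and a $(B,C)$-bimodule $Y$, $X\otimes_B Y$ is the quotient of the commutative monoid of finite formal sums of pairs $(x,y)\in X\times Y$ by the least congruence under which the class $x\otimes y$ of $(x,y)$ is additive in each variable (with $0\otimes y=x\otimes 0=0$) and $B$-balanced, $xb\otimes y=x\otimes by$; it is an $(A,C)$-bimodule via $a(x\otimes y)=(ax)\otimes y$ and $(x\otimes y)c=x\otimes(yc)$. If $Y$ is only a left $B$-module (or $X$ only a right $B$-module), the same construction gives a left $A$-module (respectively, a right $C$-module). ${}_KK_K$ denotes $K$ as a bimodule over itself by multiplication. -}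

module Defs where

open import Algebra.Bundles using (CommutativeMonoid; IdempotentSemiring; Semiring)
open import Algebra.Module.Bundles using (LeftSemimodule; RightSemimodule; Bisemimodule)
open import Algebra.Module.Morphism.Structures
  using (module LeftSemimoduleMorphisms; module RightSemimoduleMorphisms
        ; module BisemimoduleMorphisms)
import Algebra.Module.Morphism.Construct.Composition as Compose
import Algebra.Module.Morphism.Construct.Identity as Identity
import Algebra.Properties.CommutativeSemigroup as CommutativeSemigroupProperties
open import Data.List.Base using (List; []; _∷_; _++_; [_]; map)
open import Data.List.Properties using (map-++; ++-assoc; ++-identityʳ)
open import Data.Product.Base using (_×_; _,_; Σ-syntax)
open import Function.Base using () renaming (id to idᶠ; _∘_ to _∘ᶠ_)
open import Level using (Level; _⊔_; suc)
open import Relation.Binary.Core using (Rel)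
open import Relation.Binary.PropositionalEquality.Core as ≡ using (_≡_)
open import Relation.Binary.Structures using (IsEquivalence)

private
  variable
    ℓ o h e o′ h′ e′ : Level

-- The standard library's `KleeneAlgebra` is not used: its induction laws
-- have equations where the inequalities of a Kleene algebra belong
-- (b + a x ≈ x implies a ⋆ b ≈ x), and a = 1, b = 0 then gives x ≈ 0 for
-- every x.
record KleeneAlgebra (ℓ : Level) : Set (suc ℓ) where
  field
    idempotentSemiring : IdempotentSemiring ℓ ℓ

  open IdempotentSemiring idempotentSemiring public

  infix 4 _≤_
  _≤_ : Rel Carrier ℓ
  x ≤ y = x + y ≈ y

  infix 8 _⋆
  field
    _⋆         : Carrier → Carrier
    ⋆-cong     : ∀ {x y} → x ≈ y → x ⋆ ≈ y ⋆
    ⋆-unfoldʳ  : ∀ x → 1# + x * x ⋆ ≈ x ⋆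
    ⋆-unfoldˡ  : ∀ x → 1# + x ⋆ * x ≈ x ⋆
    ⋆-inductˡ  : ∀ x y z → x + y * z ≤ z → y ⋆ * x ≤ z
    ⋆-inductʳ  : ∀ x y z → x + z * y ≤ z → x * y ⋆ ≤ z

module _ (K : KleeneAlgebra ℓ) where
  private module K = KleeneAlgebra K

  IsLeftKleene : LeftSemimodule K.semiring ℓ ℓ → Set ℓ
  IsLeftKleene M = ∀ a m → a *ₗ m ≤ᴹ m → (a K.⋆) *ₗ m ≤ᴹ m
    where
    open LeftSemimodule M
    infix 4 _≤ᴹ_
    _≤ᴹ_ : Rel Carrierᴹ _
    x ≤ᴹ y = x +ᴹ y ≈ᴹ y

  IsRightKleene : RightSemimodule K.semiring ℓ ℓ → Set ℓ
  IsRightKleene M = ∀ a m → m *ᵣ a ≤ᴹ m → m *ᵣ (a K.⋆) ≤ᴹ m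
    where
    open RightSemimodule M
    infix 4 _≤ᴹ_
    _≤ᴹ_ : Rel Carrierᴹ _
    x ≤ᴹ y = x +ᴹ y ≈ᴹ y

record LeftKleeneModule (K : KleeneAlgebra ℓ) : Set (suc ℓ) where
  field
    leftSemimodule : LeftSemimodule (KleeneAlgebra.semiring K) ℓ ℓ
    isLeftKleene   : IsLeftKleene K leftSemimodule
  open LeftSemimodule leftSemimodule public

record RightKleeneModule (K : KleeneAlgebra ℓ) : Set (suc ℓ) where
  field
    rightSemimodule : RightSemimodule (KleeneAlgebra.semiring K) ℓ ℓ
    isRightKleene   : IsRightKleene K rightSemimodule
  open RightSemimodule rightSemimodule public

record KleeneBimodule (K L : KleeneAlgebra ℓ) : Set (suc ℓ) where
  field
    bisemimodule  : Bisemimodule (KleeneAlgebra.semiring K) (KleeneAlgebra.semiring L) ℓ ℓ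
  open Bisemimodule bisemimodule public
  field
    isLeftKleene  : IsLeftKleene K leftSemimodule
    isRightKleene : IsRightKleene L rightSemimodule

module _ {A : Semiring ℓ ℓ} where

  record LeftHom (P Q : LeftSemimodule A ℓ ℓ) : Set ℓ where
    private
      module P = LeftSemimodule P
      module Q = LeftSemimodule Q
    open LeftSemimoduleMorphisms P.rawLeftSemimodule Q.rawLeftSemimodule
    field
      ⟦_⟧    : P.Carrierᴹ → Q.Carrierᴹ
      isHom  : IsLeftSemimoduleHomomorphism ⟦_⟧
    open IsLeftSemimoduleHomomorphism isHom public

  record RightHom (P Q : RightSemimodule A ℓ ℓ) : Set ℓ where
    private
      module P = RightSemimodule P
      module Q = RightSemimodule Q
    open RightSemimoduleMorphisms P.rawRightSemimodule Q.rawRightSemimodule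
    field
      ⟦_⟧    : P.Carrierᴹ → Q.Carrierᴹ
      isHom  : IsRightSemimoduleHomomorphism ⟦_⟧
    open IsRightSemimoduleHomomorphism isHom public

  idˡ : (P : LeftSemimodule A ℓ ℓ) → LeftHom P P
  idˡ P = record
    { ⟦_⟧ = idᶠ ; isHom = Identity.isLeftSemimoduleHomomorphism rawLeftSemimodule ≈ᴹ-refl }
    where open LeftSemimodule P

  idʳ : (P : RightSemimodule A ℓ ℓ) → RightHom P P
  idʳ P = record
    { ⟦_⟧ = idᶠ ; isHom = Identity.isRightSemimoduleHomomorphism rawRightSemimodule ≈ᴹ-refl }
    where open RightSemimodule P

module _ {A B : Semiring ℓ ℓ} where

  record BiHom (P Q : Bisemimodule A B ℓ ℓ) : Set ℓ where
    private
      module P = Bisemimodule P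
      module Q = Bisemimodule Q
    open BisemimoduleMorphisms P.rawBisemimodule Q.rawBisemimodule
    field
      ⟦_⟧    : P.Carrierᴹ → Q.Carrierᴹ
      isHom  : IsBisemimoduleHomomorphism ⟦_⟧
    open IsBisemimoduleHomomorphism isHom public

  infix 4 _≅_
  _≅_ : (P Q : Bisemimodule A B ℓ ℓ) → Set ℓ
  P ≅ Q = Σ[ f ∈ (P.Carrierᴹ → Q.Carrierᴹ) ] IsBisemimoduleIsomorphism f
    where
    module P = Bisemimodule P
    module Q = Bisemimodule Q
    open BisemimoduleMorphisms P.rawBisemimodule Q.rawBisemimodule

  leftScale : (X : Bisemimodule A B ℓ ℓ) → Semiring.Carrier A →
              RightHom (Bisemimodule.rightSemimodule X) (Bisemimodule.rightSemimodule X)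
  leftScale X a = record
    { ⟦_⟧ = a *ₗ_
    ; isHom = record
      { +ᴹ-isMonoidHomomorphism = record
        { isMagmaHomomorphism = record
          { isRelHomomorphism = record { cong = *ₗ-congˡ }
          ; homo = *ₗ-distribˡ a }
        ; ε-homo = *ₗ-zeroʳ a }
      ; *ᵣ-homo = λ b x → ≈ᴹ-sym (*ₗ-*ᵣ-assoc a x b) } }
    where open Bisemimodule X

  rightScale : (X : Bisemimodule A B ℓ ℓ) → Semiring.Carrier B →
               LeftHom (Bisemimodule.leftSemimodule X) (Bisemimodule.leftSemimodule X)
  rightScale X b = record
    { ⟦_⟧ = _*ᵣ b
    ; isHom = record
      { +ᴹ-isMonoidHomomorphism = record
        { isMagmaHomomorphism = record
          { isRelHomomorphism = record { cong = *ᵣ-congʳ }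
          ; homo = *ᵣ-distribʳ b }
        ; ε-homo = *ᵣ-zeroˡ b }
      ; *ₗ-homo = λ a x → *ₗ-*ᵣ-assoc a x b } }
    where open Bisemimodule X

-- X ⊗_B Y. A formal sum of pairs is a list of pairs up to `++-comm`; the quotient is
-- taken by making the least congruence the setoid equality on lists.
module _ {B : Semiring ℓ ℓ} (X : RightSemimodule B ℓ ℓ) (Y : LeftSemimodule B ℓ ℓ) where
  private
    module B = Semiring B
    module X = RightSemimodule X
    module Y = LeftSemimodule Y

  FormalSum : Set ℓ
  FormalSum = List (X.Carrierᴹ × Y.Carrierᴹ)

  data TensorEq : FormalSum → FormalSum → Set ℓ where
    refl      : ∀ {u} → TensorEq u u
    sym       : ∀ {u v} → TensorEq u v → TensorEq v u
    trans     : ∀ {u v w} → TensorEq u v → TensorEq v w → TensorEq u w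
    ++-cong   : ∀ {u u′ v v′} → TensorEq u u′ → TensorEq v v′ → TensorEq (u ++ v) (u′ ++ v′)
    ++-comm   : ∀ u v → TensorEq (u ++ v) (v ++ u)
    ⊗-cong    : ∀ {x x′ y y′} → x X.≈ᴹ x′ → y Y.≈ᴹ y′ → TensorEq [ x , y ] [ x′ , y′ ]
    ⊗-addˡ    : ∀ x x′ y → TensorEq [ x X.+ᴹ x′ , y ] ((x , y) ∷ (x′ , y) ∷ [])
    ⊗-addʳ    : ∀ x y y′ → TensorEq [ x , y Y.+ᴹ y′ ] ((x , y) ∷ (x , y′) ∷ [])
    ⊗-zeroˡ   : ∀ y → TensorEq [ X.0ᴹ , y ] []
    ⊗-zeroʳ   : ∀ x → TensorEq [ x , Y.0ᴹ ] []
    ⊗-balance : ∀ x b y → TensorEq [ x X.*ᵣ b , y ] [ x , b Y.*ₗ y ]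

  tensorMonoid : CommutativeMonoid ℓ ℓ
  tensorMonoid = record
    { Carrier = FormalSum
    ; _≈_ = TensorEq
    ; _∙_ = _++_
    ; ε = []
    ; isCommutativeMonoid = record
      { isMonoid = record
        { isSemigroup = record
          { isMagma = record
            { isEquivalence = record { refl = refl ; sym = sym ; trans = trans }
            ; ∙-cong = ++-cong }
          ; assoc = λ u v w → reflexive (++-assoc u v w) }
        ; identity = (λ _ → refl) , (λ u → reflexive (++-identityʳ u)) }
      ; comm = ++-comm } }
    where
    reflexive : ∀ {u v} → u ≡ v → TensorEq u v
    reflexive ≡.refl = refl

mapSum : ∀ {a b c d} {X : Set a} {X′ : Set b} {Y : Set c} {Y′ : Set d} →
         (X → X′) → (Y → Y′) → List (X × Y) → List (X′ × Y′)
mapSum f g = map (λ { (x , y) → f x , g y })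

module _ {B : Semiring ℓ ℓ}
         {X X′ : RightSemimodule B ℓ ℓ} {Y Y′ : LeftSemimodule B ℓ ℓ} where
  private
    module X′ = RightSemimodule X′
    module Y′ = LeftSemimodule Y′

  mapSum-resp : (f : RightHom X X′) (g : LeftHom Y Y′) → ∀ {u v} → TensorEq X Y u v →
                TensorEq X′ Y′ (mapSum (RightHom.⟦_⟧ f) (LeftHom.⟦_⟧ g) u)
                               (mapSum (RightHom.⟦_⟧ f) (LeftHom.⟦_⟧ g) v)
  mapSum-resp f g = go
    where
    module f = RightHom f
    module g = LeftHom g
    F : FormalSum X Y → FormalSum X′ Y′
    F = mapSum f.⟦_⟧ g.⟦_⟧
    F-++ : ∀ u v → F (u ++ v) ≡ F u ++ F v
    F-++ = map-++ _
    go : ∀ {u v} → TensorEq X Y u v → TensorEq X′ Y′ (F u) (F v)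
    go refl = refl
    go (sym p) = sym (go p)
    go (trans p q) = trans (go p) (go q)
    go (++-cong {u} {u′} {v} {v′} p q) =
      ≡.subst₂ (TensorEq X′ Y′) (≡.sym (F-++ u v)) (≡.sym (F-++ u′ v′)) (++-cong (go p) (go q))
    go (++-comm u v) =
      ≡.subst₂ (TensorEq X′ Y′) (≡.sym (F-++ u v)) (≡.sym (F-++ v u)) (++-comm (F u) (F v))
    go (⊗-cong p q) = ⊗-cong (f.⟦⟧-cong p) (g.⟦⟧-cong q)
    go (⊗-addˡ x x′ y) = trans (⊗-cong (f.+ᴹ-homo x x′) Y′.≈ᴹ-refl) (⊗-addˡ _ _ _)
    go (⊗-addʳ x y y′) = trans (⊗-cong X′.≈ᴹ-refl (g.+ᴹ-homo y y′)) (⊗-addʳ _ _ _)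
    go (⊗-zeroˡ y) = trans (⊗-cong f.0ᴹ-homo Y′.≈ᴹ-refl) (⊗-zeroˡ _)
    go (⊗-zeroʳ x) = trans (⊗-cong X′.≈ᴹ-refl g.0ᴹ-homo) (⊗-zeroʳ _)
    go (⊗-balance x b y) =
      trans (⊗-cong (f.*ᵣ-homo b x) Y′.≈ᴹ-refl)
      (trans (⊗-balance _ _ _)
             (⊗-cong X′.≈ᴹ-refl (Y′.≈ᴹ-sym (g.*ₗ-homo b y))))

module _ {A B : Semiring ℓ ℓ} (X : Bisemimodule A B ℓ ℓ) (Y : LeftSemimodule B ℓ ℓ) where
  private
    module A = Semiring A
    module X = Bisemimodule X
    module Y = LeftSemimodule Y
    module T = CommutativeMonoid (tensorMonoid X.rightSemimodule Y)
    open CommutativeSemigroupProperties T.commutativeSemigroup using (interchange)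

    act : A.Carrier → T.Carrier → T.Carrier
    act a = mapSum (a X.*ₗ_) idᶠ

    act-cong : ∀ {a a′ u v} → a A.≈ a′ → u T.≈ v → act a u T.≈ act a′ v
    act-cong {a} {a′} {u} {v} p q =
      T.trans (mapSum-resp (leftScale X a) (idˡ Y) q) (go v)
      where
      go : ∀ v → act a v T.≈ act a′ v
      go [] = refl
      go ((x , y) ∷ v) = ++-cong (⊗-cong (X.*ₗ-congʳ p) Y.≈ᴹ-refl) (go v)

    act-zeroˡ : ∀ u → act A.0# u T.≈ []
    act-zeroˡ [] = refl
    act-zeroˡ ((x , y) ∷ u) =
      ++-cong (trans (⊗-cong (X.*ₗ-zeroˡ x) Y.≈ᴹ-refl) (⊗-zeroˡ y)) (act-zeroˡ u)

    act-distribʳ : ∀ u a b → act (a A.+ b) u T.≈ act a u ++ act b u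
    act-distribʳ [] a b = refl
    act-distribʳ ((x , y) ∷ u) a b = T.trans
      (++-cong (trans (⊗-cong (X.*ₗ-distribʳ x a b) Y.≈ᴹ-refl) (⊗-addˡ _ _ _))
               (act-distribʳ u a b))
      (interchange [ a X.*ₗ x , y ] [ b X.*ₗ x , y ] (act a u) (act b u))

    act-identity : ∀ u → act A.1# u T.≈ u
    act-identity [] = refl
    act-identity ((x , y) ∷ u) = ++-cong (⊗-cong (X.*ₗ-identityˡ x) Y.≈ᴹ-refl) (act-identity u)

    act-assoc : ∀ a b u → act (a A.* b) u T.≈ act a (act b u)
    act-assoc a b [] = refl
    act-assoc a b ((x , y) ∷ u) = ++-cong (⊗-cong (X.*ₗ-assoc a b x) Y.≈ᴹ-refl) (act-assoc a b u)

  infixl 7 _⊗ₗ_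
  _⊗ₗ_ : LeftSemimodule A ℓ ℓ
  _⊗ₗ_ = record
    { Carrierᴹ = T.Carrier
    ; _≈ᴹ_ = T._≈_
    ; _+ᴹ_ = T._∙_
    ; _*ₗ_ = act
    ; 0ᴹ = T.ε
    ; isLeftSemimodule = record
      { +ᴹ-isCommutativeMonoid = T.isCommutativeMonoid
      ; isPreleftSemimodule = record
        { *ₗ-cong = act-cong
        ; *ₗ-zeroˡ = act-zeroˡ
        ; *ₗ-distribʳ = act-distribʳ
        ; *ₗ-identityˡ = act-identity
        ; *ₗ-assoc = act-assoc
        ; *ₗ-zeroʳ = λ _ → refl
        ; *ₗ-distribˡ = λ a u v → T.reflexive (map-++ _ u v) } } }

module _ {B C : Semiring ℓ ℓ} (X : RightSemimodule B ℓ ℓ) (Y : Bisemimodule B C ℓ ℓ) where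
  private
    module C = Semiring C
    module X = RightSemimodule X
    module Y = Bisemimodule Y
    module T = CommutativeMonoid (tensorMonoid X Y.leftSemimodule)
    open CommutativeSemigroupProperties T.commutativeSemigroup using (interchange)

    act : T.Carrier → C.Carrier → T.Carrier
    act u c = mapSum idᶠ (Y._*ᵣ c) u

    act-cong : ∀ {u v c c′} → u T.≈ v → c C.≈ c′ → act u c T.≈ act v c′
    act-cong {u} {v} {c} {c′} q p =
      T.trans (mapSum-resp (idʳ X) (rightScale Y c) q) (go v)
      where
      go : ∀ v → act v c T.≈ act v c′
      go [] = refl
      go ((x , y) ∷ v) = ++-cong (⊗-cong X.≈ᴹ-refl (Y.*ᵣ-congˡ p)) (go v)

    act-zeroʳ : ∀ u → act u C.0# T.≈ []
    act-zeroʳ [] = refl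
    act-zeroʳ ((x , y) ∷ u) =
      ++-cong (trans (⊗-cong X.≈ᴹ-refl (Y.*ᵣ-zeroʳ y)) (⊗-zeroʳ x)) (act-zeroʳ u)

    act-distribˡ : ∀ u c d → act u (c C.+ d) T.≈ act u c ++ act u d
    act-distribˡ [] c d = refl
    act-distribˡ ((x , y) ∷ u) c d = T.trans
      (++-cong (trans (⊗-cong X.≈ᴹ-refl (Y.*ᵣ-distribˡ y c d)) (⊗-addʳ _ _ _))
               (act-distribˡ u c d))
      (interchange [ x , y Y.*ᵣ c ] [ x , y Y.*ᵣ d ] (act u c) (act u d))

    act-identity : ∀ u → act u C.1# T.≈ u
    act-identity [] = refl
    act-identity ((x , y) ∷ u) = ++-cong (⊗-cong X.≈ᴹ-refl (Y.*ᵣ-identityʳ y)) (act-identity u)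

    act-assoc : ∀ u c d → act (act u c) d T.≈ act u (c C.* d)
    act-assoc [] c d = refl
    act-assoc ((x , y) ∷ u) c d = ++-cong (⊗-cong X.≈ᴹ-refl (Y.*ᵣ-assoc y c d)) (act-assoc u c d)

  infixl 7 _⊗ᵣ_
  _⊗ᵣ_ : RightSemimodule C ℓ ℓ
  _⊗ᵣ_ = record
    { Carrierᴹ = T.Carrier
    ; _≈ᴹ_ = T._≈_
    ; _+ᴹ_ = T._∙_
    ; _*ᵣ_ = act
    ; 0ᴹ = T.ε
    ; isRightSemimodule = record
      { +ᴹ-isCommutativeMonoid = T.isCommutativeMonoid
      ; isPrerightSemimodule = record
        { *ᵣ-cong = act-cong
        ; *ᵣ-zeroʳ = act-zeroʳ
        ; *ᵣ-distribˡ = act-distribˡ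
        ; *ᵣ-identityʳ = act-identity
        ; *ᵣ-assoc = act-assoc
        ; *ᵣ-zeroˡ = λ _ → refl
        ; *ᵣ-distribʳ = λ c u v → T.reflexive (map-++ _ u v) } } }

module _ {A B C : Semiring ℓ ℓ} where

  infixl 7 _⊗_
  _⊗_ : Bisemimodule A B ℓ ℓ → Bisemimodule B C ℓ ℓ → Bisemimodule A C ℓ ℓ
  X ⊗ Y = record
    { Carrierᴹ = L.Carrierᴹ
    ; _≈ᴹ_ = L._≈ᴹ_
    ; _+ᴹ_ = L._+ᴹ_
    ; _*ₗ_ = L._*ₗ_
    ; _*ᵣ_ = R._*ᵣ_
    ; 0ᴹ = L.0ᴹ
    ; isBisemimodule = record
      { +ᴹ-isCommutativeMonoid = L.+ᴹ-isCommutativeMonoid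
      ; isPreleftSemimodule = L.isPreleftSemimodule
      ; isPrerightSemimodule = R.isPrerightSemimodule
      ; *ₗ-*ᵣ-assoc = assoc } }
    where
    module L = LeftSemimodule (X ⊗ₗ Bisemimodule.leftSemimodule Y)
    module R = RightSemimodule (Bisemimodule.rightSemimodule X ⊗ᵣ Y)
    assoc : ∀ a u c → (a L.*ₗ u) R.*ᵣ c L.≈ᴹ a L.*ₗ (u R.*ᵣ c)
    assoc a [] c = refl
    assoc a ((x , y) ∷ u) c = ++-cong refl (assoc a u c)

module _ {A B : Semiring ℓ ℓ} (X : Bisemimodule A B ℓ ℓ) {P Q : LeftSemimodule B ℓ ℓ} where
  private module X = Bisemimodule X

  infixl 7 _⊗₁_
  _⊗₁_ : LeftHom P Q → LeftHom (X ⊗ₗ P) (X ⊗ₗ Q)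
  _⊗₁_ f = record
    { ⟦_⟧ = F
    ; isHom = record
      { +ᴹ-isMonoidHomomorphism = record
        { isMagmaHomomorphism = record
          { isRelHomomorphism = record { cong = mapSum-resp (idʳ X.rightSemimodule) f }
          ; homo = λ u v → T.≈ᴹ-reflexive (map-++ _ u v) }
        ; ε-homo = refl }
      ; *ₗ-homo = scale } }
    where
    module f = LeftHom f
    module T = LeftSemimodule (X ⊗ₗ Q)
    module S = LeftSemimodule (X ⊗ₗ P)
    F : S.Carrierᴹ → T.Carrierᴹ
    F = mapSum idᶠ f.⟦_⟧
    scale : ∀ a u → F (a S.*ₗ u) T.≈ᴹ a T.*ₗ F u
    scale a [] = refl
    scale a ((x , p) ∷ u) = ++-cong refl (scale a u)

record Category (o h e : Level) : Set (suc (o ⊔ h ⊔ e)) where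
  infix  4 _≈_ _⇒_
  infixr 9 _∘_
  field
    Obj       : Set o
    _⇒_       : Rel Obj h
    _≈_       : ∀ {A B} → Rel (A ⇒ B) e
    id        : ∀ {A} → A ⇒ A
    _∘_       : ∀ {A B C} → B ⇒ C → A ⇒ B → A ⇒ C
    equiv     : ∀ {A B} → IsEquivalence (_≈_ {A} {B})
    ∘-resp-≈  : ∀ {A B C} {f f′ : B ⇒ C} {g g′ : A ⇒ B} → f ≈ f′ → g ≈ g′ → f ∘ g ≈ f′ ∘ g′
    assoc     : ∀ {A B C D} (f : A ⇒ B) (g : B ⇒ C) (h : C ⇒ D) → (h ∘ g) ∘ f ≈ h ∘ (g ∘ f)
    identityˡ : ∀ {A B} (f : A ⇒ B) → id ∘ f ≈ f
    identityʳ : ∀ {A B} (f : A ⇒ B) → f ∘ id ≈ f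

record Functor (C : Category o h e) (D : Category o′ h′ e′)
               : Set (o ⊔ h ⊔ e ⊔ o′ ⊔ h′ ⊔ e′) where
  private
    module C = Category C
    module D = Category D
  field
    F₀           : C.Obj → D.Obj
    F₁           : ∀ {A B} → A C.⇒ B → F₀ A D.⇒ F₀ B
    F-resp-≈     : ∀ {A B} {f g : A C.⇒ B} → f C.≈ g → F₁ f D.≈ F₁ g
    identity     : ∀ {A} → F₁ (C.id {A}) D.≈ D.id
    homomorphism : ∀ {A B E} (f : A C.⇒ B) (g : B C.⇒ E) → F₁ (g C.∘ f) D.≈ F₁ g D.∘ F₁ f

idFunctor : (C : Category o h e) → Functor C C
idFunctor C = record
  { F₀ = idᶠ
  ; F₁ = idᶠ
  ; F-resp-≈ = idᶠ
  ; identity = IsEquivalence.refl equiv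
  ; homomorphism = λ _ _ → IsEquivalence.refl equiv }
  where open Category C

infixr 9 _∘F_
_∘F_ : ∀ {o″ h″ e″} {C : Category o h e} {D : Category o′ h′ e′} {E : Category o″ h″ e″} →
       Functor D E → Functor C D → Functor C E
_∘F_ {E = E} G F = record
  { F₀ = G.F₀ ∘ᶠ F.F₀
  ; F₁ = G.F₁ ∘ᶠ F.F₁
  ; F-resp-≈ = G.F-resp-≈ ∘ᶠ F.F-resp-≈
  ; identity = E.trans (G.F-resp-≈ F.identity) G.identity
  ; homomorphism = λ f g → E.trans (G.F-resp-≈ (F.homomorphism f g)) (G.homomorphism _ _) }
  where
  module F = Functor F
  module G = Functor G
  module E {A} {B} = IsEquivalence (Category.equiv E {A} {B})

record NaturalIsomorphism {C : Category o h e} {D : Category o′ h′ e′} (F G : Functor C D)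
                          : Set (o ⊔ h ⊔ h′ ⊔ e′) where
  private
    module C = Category C
    module F = Functor F
    module G = Functor G
  open Category D
  field
    η       : ∀ A → F.F₀ A ⇒ G.F₀ A
    η⁻¹     : ∀ A → G.F₀ A ⇒ F.F₀ A
    natural : ∀ {A B} (f : A C.⇒ B) → η B ∘ F.F₁ f ≈ G.F₁ f ∘ η A
    isoˡ    : ∀ A → η⁻¹ A ∘ η A ≈ id
    isoʳ    : ∀ A → η A ∘ η⁻¹ A ≈ id

record IsEquivalenceOfCategories {C : Category o h e} {D : Category o′ h′ e′}
                                 (F : Functor C D) (G : Functor D C)
                                 : Set (o ⊔ h ⊔ e ⊔ o′ ⊔ h′ ⊔ e′) where
  field
    unit   : NaturalIsomorphism (idFunctor C) (G ∘F F)
    counit : NaturalIsomorphism (F ∘F G) (idFunctor D)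

infix 4 _≃_
record _≃_ (C : Category o h e) (D : Category o′ h′ e′)
           : Set (o ⊔ h ⊔ e ⊔ o′ ⊔ h′ ⊔ e′) where
  field
    to            : Functor C D
    from          : Functor D C
    isEquivalence : IsEquivalenceOfCategories to from

LeftKleeneModules : KleeneAlgebra ℓ → Category (suc ℓ) ℓ ℓ
LeftKleeneModules K = record
  { Obj = LeftKleeneModule K
  ; _⇒_ = λ P Q → LeftHom (leftSemimodule P) (leftSemimodule Q)
  ; _≈_ = λ {P} {Q} f g → ∀ x → _≈ᴹ_ Q (⟦ f ⟧ x) (⟦ g ⟧ x)
  ; id = λ {P} → idˡ (leftSemimodule P)
  ; _∘_ = λ {_} {_} {R} g f → record
      { ⟦_⟧ = ⟦ g ⟧ ∘ᶠ ⟦ f ⟧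
      ; isHom = Compose.isLeftSemimoduleHomomorphism (≈ᴹ-trans R) (isHom f) (isHom g) }
  ; equiv = λ {_} {Q} → record
      { refl = λ _ → ≈ᴹ-refl Q
      ; sym = λ p x → ≈ᴹ-sym Q (p x)
      ; trans = λ p q x → ≈ᴹ-trans Q (p x) (q x) }
  ; ∘-resp-≈ = λ {_} {_} {R} {f} {_} {_} {g′} p q x →
      ≈ᴹ-trans R (⟦⟧-cong f (q x)) (p (⟦ g′ ⟧ x))
  ; assoc = λ {_} {_} {_} {R} _ _ _ _ → ≈ᴹ-refl R
  ; identityˡ = λ {_} {Q} _ _ → ≈ᴹ-refl Q
  ; identityʳ = λ {_} {Q} _ _ → ≈ᴹ-refl Q }
  where
  open LeftKleeneModule
  open LeftHom

RightKleeneModules : KleeneAlgebra ℓ → Category (suc ℓ) ℓ ℓ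
RightKleeneModules K = record
  { Obj = RightKleeneModule K
  ; _⇒_ = λ P Q → RightHom (rightSemimodule P) (rightSemimodule Q)
  ; _≈_ = λ {P} {Q} f g → ∀ x → _≈ᴹ_ Q (⟦ f ⟧ x) (⟦ g ⟧ x)
  ; id = λ {P} → idʳ (rightSemimodule P)
  ; _∘_ = λ {_} {_} {R} g f → record
      { ⟦_⟧ = ⟦ g ⟧ ∘ᶠ ⟦ f ⟧
      ; isHom = Compose.isRightSemimoduleHomomorphism (≈ᴹ-trans R) (isHom f) (isHom g) }
  ; equiv = λ {_} {Q} → record
      { refl = λ _ → ≈ᴹ-refl Q
      ; sym = λ p x → ≈ᴹ-sym Q (p x)
      ; trans = λ p q x → ≈ᴹ-trans Q (p x) (q x) }
  ; ∘-resp-≈ = λ {_} {_} {R} {f} {_} {_} {g′} p q x →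
      ≈ᴹ-trans R (⟦⟧-cong f (q x)) (p (⟦ g′ ⟧ x))
  ; assoc = λ {_} {_} {_} {R} _ _ _ _ → ≈ᴹ-refl R
  ; identityˡ = λ {_} {Q} _ _ → ≈ᴹ-refl Q
  ; identityʳ = λ {_} {Q} _ _ → ≈ᴹ-refl Q }
  where
  open RightKleeneModule
  open RightHom

KleeneBimodules : KleeneAlgebra ℓ → KleeneAlgebra ℓ → Category (suc ℓ) ℓ ℓ
KleeneBimodules K L = record
  { Obj = KleeneBimodule K L
  ; _⇒_ = λ P Q → BiHom (bisemimodule P) (bisemimodule Q)
  ; _≈_ = λ {P} {Q} f g → ∀ x → _≈ᴹ_ Q (⟦ f ⟧ x) (⟦ g ⟧ x)
  ; id = λ {P} → record
      { ⟦_⟧ = idᶠ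
      ; isHom = Identity.isBisemimoduleHomomorphism (rawBisemimodule P) (≈ᴹ-refl P) }
  ; _∘_ = λ {_} {_} {R} g f → record
      { ⟦_⟧ = ⟦ g ⟧ ∘ᶠ ⟦ f ⟧
      ; isHom = Compose.isBisemimoduleHomomorphism (≈ᴹ-trans R) (isHom f) (isHom g) }
  ; equiv = λ {_} {Q} → record
      { refl = λ _ → ≈ᴹ-refl Q
      ; sym = λ p x → ≈ᴹ-sym Q (p x)
      ; trans = λ p q x → ≈ᴹ-trans Q (p x) (q x) }
  ; ∘-resp-≈ = λ {_} {_} {R} {f} {_} {_} {g′} p q x →
      ≈ᴹ-trans R (⟦⟧-cong f (q x)) (p (⟦ g′ ⟧ x))
  ; assoc = λ {_} {_} {_} {R} _ _ _ _ → ≈ᴹ-refl R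
  ; identityˡ = λ {_} {Q} _ _ → ≈ᴹ-refl Q
  ; identityʳ = λ {_} {Q} _ _ → ≈ᴹ-refl Q }
  where
  open KleeneBimodule
  open BiHom

-- The module axioms of X ⊗ₗ P say nothing about the star, so this is an argument
-- of `tensorFunctor`; a theorem about that functor has to establish it first.
PreservesLeftKleene : (K S : KleeneAlgebra ℓ) →
                      Bisemimodule (KleeneAlgebra.semiring S) (KleeneAlgebra.semiring K) ℓ ℓ →
                      Set (suc ℓ)
PreservesLeftKleene K S X =
  (P : LeftKleeneModule K) → IsLeftKleene S (X ⊗ₗ LeftKleeneModule.leftSemimodule P)

tensorFunctor : (K S : KleeneAlgebra ℓ)
                (X : Bisemimodule (KleeneAlgebra.semiring S) (KleeneAlgebra.semiring K) ℓ ℓ) →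
                PreservesLeftKleene K S X →
                Functor (LeftKleeneModules K) (LeftKleeneModules S)
tensorFunctor K S X kleene = record
  { F₀ = λ P → record
      { leftSemimodule = X ⊗ₗ leftSemimodule P
      ; isLeftKleene = kleene P }
  ; F₁ = λ f → X ⊗₁ f
  ; F-resp-≈ = λ {P} {Q} {f} {g} → resp P Q f g
  ; identity = λ {P} → ident P
  ; homomorphism = λ {P} {Q} {R} → homo P Q R }
  where
  open LeftKleeneModule
  open LeftHom
  module X = Bisemimodule X

  Eq : (P : LeftKleeneModule K) → Rel (LeftSemimodule.Carrierᴹ (X ⊗ₗ leftSemimodule P)) _
  Eq P = LeftSemimodule._≈ᴹ_ (X ⊗ₗ leftSemimodule P)

  resp : ∀ P Q (f g : LeftHom (leftSemimodule P) (leftSemimodule Q)) →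
         (∀ p → _≈ᴹ_ Q (⟦ f ⟧ p) (⟦ g ⟧ p)) → ∀ u → Eq Q (⟦ X ⊗₁ f ⟧ u) (⟦ X ⊗₁ g ⟧ u)
  resp P Q f g eq [] = refl
  resp P Q f g eq ((x , p) ∷ u) = ++-cong (⊗-cong X.≈ᴹ-refl (eq p)) (resp P Q f g eq u)

  ident : ∀ P u → Eq P (⟦ X ⊗₁ idˡ (leftSemimodule P) ⟧ u) u
  ident P [] = refl
  ident P (_ ∷ u) = ++-cong refl (ident P u)

  homo : ∀ P Q R (f : LeftHom (leftSemimodule P) (leftSemimodule Q))
         (g : LeftHom (leftSemimodule Q) (leftSemimodule R)) →
         ∀ u → Eq R (mapSum idᶠ (⟦ g ⟧ ∘ᶠ ⟦ f ⟧) u) (⟦ X ⊗₁ g ⟧ (⟦ X ⊗₁ f ⟧ u))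
  homo P Q R f g [] = refl
  homo P Q R f g (_ ∷ u) = ++-cong refl (homo P Q R f g u)

{-# OPTIONS --safe #-}

-- Write ⟨ m , n ⟩ ∈ K and ⟨ n , m ⟩ ∈ S for the images of pure tensors under the two given
-- isomorphisms. If Σ ⟨ mⱼ , nⱼ ⟩ = 1, then p ↦ Σ mⱼ ⊗ (nⱼ ⊗ p) is inverse to
-- m ⊗ (n ⊗ p) ↦ ⟨ m , n ⟩ p, so for plain semimodules the two functors are inverse up to
-- natural isomorphism; what has to be shown is that tensoring preserves the Kleene axioms.
--
-- Let s ∈ S and v ∈ N ⊗ P with s v ≤ v. If s = ⟨ x , m ⟩ is a single pairing, its powers are
-- controlled by those of an element c of K, namely s⋆ ≤ 1 + ⟨ x c⋆ , m ⟩, and the Kleene axiom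
-- of P for c gives s⋆ v ≤ v. Every element of S is a finite sum of pairings, and sums are
-- handled by (x + y)⋆ ≤ (x⋆ y)⋆ x⋆, where x⋆ y is a single pairing if y is one. For a right
-- action on P, the axiom passes to N ⊗ P because the maps n ⊗ p ↦ ⟨ m , n ⟩ p, for m ∈ M,
-- jointly reflect the order. Right modules and the other side of bimodules are reduced to
-- this by passing to opposite algebras.

module Submission where

open import Defs renaming (refl to ≋-refl; sym to ≋-sym; trans to ≋-trans)
open import Level using (Level)
open import Data.Product.Base using (_×_; Σ-syntax)
open import Algebra.Module.Construct.TensorUnit using () renaming (bisemimodule to tensorUnit)
open import Algebra.Bundles using (CommutativeMonoid; Semiring)
import Algebra.Construct.Flip.Op as Op
open import Algebra.Module.Bundles using (LeftSemimodule; RightSemimodule; Bisemimodule)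
import Algebra.Module.Morphism.Construct.Identity as Identity
open import Algebra.Module.Morphism.Structures using (module BisemimoduleMorphisms)
import Algebra.Properties.CommutativeSemigroup as CommutativeSemigroupProperties
open import Data.List.Base using (List; []; _∷_; _++_; [_])
open import Data.Product.Base using (_,_; proj₁; proj₂)
open import Function.Base using (flip) renaming (id to idᶠ)
import Relation.Binary.Reasoning.Setoid as ≈-Reasoning
open import Relation.Binary.Bundles using (Setoid)
open import Relation.Binary.Structures using (IsEquivalence)

private
  variable
    ℓ o h e o′ h′ e′ o″ h″ e″ : Level

-- The natural order of an idempotent commutative monoid, and star inequalities

module NaturalOrder (Z : CommutativeMonoid ℓ ℓ)
                    (idem : ∀ x → CommutativeMonoid._≈_ Z (CommutativeMonoid._∙_ Z x x) x) where
  open CommutativeMonoid Z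
  open CommutativeSemigroupProperties commutativeSemigroup using (interchange)

  infix 4 _≤_
  _≤_ : Carrier → Carrier → Set _
  x ≤ y = x ∙ y ≈ y

  ≤-reflexive : ∀ {x y} → x ≈ y → x ≤ y
  ≤-reflexive p = trans (∙-congʳ p) (idem _)

  ≤-trans : ∀ {x y z} → x ≤ y → y ≤ z → x ≤ z
  ≤-trans p q = trans (∙-congˡ (sym q)) (trans (sym (assoc _ _ _)) (trans (∙-congʳ p) q))

  ≤-respˡ : ∀ {x x′ y} → x ≈ x′ → x ≤ y → x′ ≤ y
  ≤-respˡ p q = trans (∙-congʳ (sym p)) q

  ≤-respʳ : ∀ {x y y′} → y ≈ y′ → x ≤ y → x ≤ y′
  ≤-respʳ p q = trans (∙-congˡ (sym p)) (trans q p)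

  ∙-lub : ∀ {x y z} → x ≤ z → y ≤ z → x ∙ y ≤ z
  ∙-lub p q = trans (assoc _ _ _) (trans (∙-congˡ q) p)

  ∙-mono : ∀ {x x′ y y′} → x ≤ x′ → y ≤ y′ → x ∙ y ≤ x′ ∙ y′
  ∙-mono p q = trans (interchange _ _ _ _) (∙-cong p q)

  x≤x∙y : ∀ x y → x ≤ x ∙ y
  x≤x∙y x y = trans (sym (assoc _ _ _)) (∙-congʳ (idem x))

  y≤x∙y : ∀ x y → y ≤ x ∙ y
  y≤x∙y x y = ≤-respʳ (comm y x) (x≤x∙y y x)

module KleeneProperties (K : KleeneAlgebra ℓ) where
  open KleeneAlgebra K hiding (_≤_)
  open NaturalOrder +-commutativeMonoid +-idem public

  *-monoˡ : ∀ {x y} z → x ≤ y → x * z ≤ y * z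
  *-monoˡ z p = trans (sym (distribʳ z _ _)) (*-congʳ p)

  1≤x⋆ : ∀ x → 1# ≤ x ⋆
  1≤x⋆ x = ≤-respʳ (⋆-unfoldʳ x) (x≤x∙y _ _)

  x*x⋆≤x⋆ : ∀ x → x * x ⋆ ≤ x ⋆
  x*x⋆≤x⋆ x = ≤-respʳ (⋆-unfoldʳ x) (y≤x∙y _ _)

  x⋆*x≤x⋆ : ∀ x → x ⋆ * x ≤ x ⋆
  x⋆*x≤x⋆ x = ≤-respʳ (⋆-unfoldˡ x) (y≤x∙y _ _)

  -- The induction law with base `1#`: x⋆ = x⋆ 1 is bounded by anything above 1 that absorbs left
  -- multiplication by x.
  ⋆-leastˡ : ∀ {x t} → 1# ≤ t → x * t ≤ t → x ⋆ ≤ t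
  ⋆-leastˡ {x} {t} p q = ≤-respˡ (*-identityʳ _) (⋆-inductˡ 1# x t (∙-lub p q))

  ⋆-leastʳ : ∀ {x t} → 1# ≤ t → t * x ≤ t → x ⋆ ≤ t
  ⋆-leastʳ {x} {t} p q = ≤-respˡ (*-identityˡ _) (⋆-inductʳ 1# x t (∙-lub p q))

  0⋆≤1 : 0# ⋆ ≤ 1#
  0⋆≤1 = ⋆-leastˡ (≤-reflexive refl) (trans (+-congʳ (zeroˡ 1#)) (+-identityˡ 1#))

  x≤y*x : ∀ {x y} → 1# ≤ y → x ≤ y * x
  x≤y*x {x} p = ≤-respˡ (*-identityˡ x) (*-monoˡ x p)

  -- One half of the denesting law. The right-hand side t lies above 1 and absorbs left
  -- multiplication by x and by y, so `⋆-leastˡ` applies.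
  +-⋆-bound : ∀ x y → (x + y) ⋆ ≤ (x ⋆ * y) ⋆ * x ⋆
  +-⋆-bound x y = ⋆-leastˡ 1≤t (≤-respˡ (sym (distribʳ t x y)) (∙-lub xt≤t yt≤t))
    where
    z t : Carrier
    z = x ⋆ * y
    t = z ⋆ * x ⋆

    x⋆≤t : x ⋆ ≤ t
    x⋆≤t = x≤y*x (1≤x⋆ z)

    1≤t : 1# ≤ t
    1≤t = ≤-trans (1≤x⋆ x) x⋆≤t

    zt≤t : z * t ≤ t
    zt≤t = ≤-respˡ (*-assoc _ _ _) (*-monoˡ (x ⋆) (x*x⋆≤x⋆ z))

    yt≤t : y * t ≤ t
    yt≤t = ≤-trans (*-monoˡ t (x≤y*x (1≤x⋆ x))) zt≤t

    -- Unfolding the outer star splits x t into x x⋆ and x z t. Both are absorbed by t, the second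
    -- because x x⋆ y ≤ x⋆ y.
    t-unfold : x ⋆ + z * t ≈ t
    t-unfold = trans (+-cong (sym (*-identityˡ _)) (sym (*-assoc _ _ _)))
                     (trans (sym (distribʳ _ _ _)) (*-congʳ (⋆-unfoldʳ z)))

    xzt≤t : x * (z * t) ≤ t
    xzt≤t = ≤-trans
      (≤-respˡ (*-assoc x z t)
        (*-monoˡ t (≤-respˡ (*-assoc x (x ⋆) y) (*-monoˡ y (x*x⋆≤x⋆ x)))))
      zt≤t

    xt≤t : x * t ≤ t
    xt≤t = ≤-respˡ (trans (sym (distribˡ x _ _)) (*-congˡ t-unfold))
                   (∙-lub (≤-trans (x*x⋆≤x⋆ x) x⋆≤t) xzt≤t)

-- The order on a module over a Kleene algebra

module LeftAction (K : KleeneAlgebra ℓ)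
                  (P : LeftSemimodule (KleeneAlgebra.semiring K) ℓ ℓ) where
  private module K where
    open KleeneAlgebra K hiding (_≤_) public
    open KleeneProperties K public
  open K using (_⋆)
  open LeftSemimodule P

  -- Idempotence is inherited from 1 + 1 = 1 in K. It makes `NaturalOrder` available on every module
  -- over K.
  +ᴹ-idem : ∀ x → x +ᴹ x ≈ᴹ x
  +ᴹ-idem x = begin
    x +ᴹ x                      ≈⟨ +ᴹ-cong (*ₗ-identityˡ x) (*ₗ-identityˡ x) ⟨
    K.1# *ₗ x +ᴹ K.1# *ₗ x      ≈⟨ *ₗ-distribʳ x K.1# K.1# ⟨
    (K.1# K.+ K.1#) *ₗ x        ≈⟨ *ₗ-congʳ (K.+-idem K.1#) ⟩
    K.1# *ₗ x                   ≈⟨ *ₗ-identityˡ x ⟩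
    x                           ∎
    where open ≈-Reasoning ≈ᴹ-setoid

  open NaturalOrder +ᴹ-commutativeMonoid +ᴹ-idem public

  *ₗ-monoʳ : ∀ a {x y} → x ≤ y → a *ₗ x ≤ a *ₗ y
  *ₗ-monoʳ a p = ≈ᴹ-trans (≈ᴹ-sym (*ₗ-distribˡ a _ _)) (*ₗ-congˡ p)

  *ₗ-monoˡ : ∀ {a b} x → a K.≤ b → a *ₗ x ≤ b *ₗ x
  *ₗ-monoˡ x p = ≈ᴹ-trans (≈ᴹ-sym (*ₗ-distribʳ x _ _)) (*ₗ-congʳ p)

  infix 4 _Decreases_
  -- For fixed x, these scalars form a down-closed set containing 1 and closed under sums and
  -- products. The Kleene axiom asks for closure under star, so it can be checked on any upper bound
  -- of a⋆ built from such scalars.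
  _Decreases_ : K.Carrier → Carrierᴹ → Set _
  a Decreases x = a *ₗ x ≤ x

  decreases-≤ : ∀ {a b x} → a K.≤ b → b Decreases x → a Decreases x
  decreases-≤ p q = ≤-trans (*ₗ-monoˡ _ p) q

  decreases-1 : ∀ x → K.1# Decreases x
  decreases-1 x = ≤-reflexive (*ₗ-identityˡ x)

  decreases-+ : ∀ {a b x} → a Decreases x → b Decreases x → a K.+ b Decreases x
  decreases-+ p q = ≤-respˡ (≈ᴹ-sym (*ₗ-distribʳ _ _ _)) (∙-lub p q)

  decreases-* : ∀ {a b x} → a Decreases x → b Decreases x → a K.* b Decreases x
  decreases-* p q = ≤-respˡ (≈ᴹ-sym (*ₗ-assoc _ _ _)) (≤-trans (*ₗ-monoʳ _ q) p)

-- Tensor products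

module _ {X Y : Set ℓ} (Z : CommutativeMonoid ℓ ℓ) where
  open CommutativeMonoid Z
  open CommutativeSemigroupProperties commutativeSemigroup using (interchange)

  -- The monoid homomorphism on formal sums induced by f. The fold ends in `ε`, so a one-term sum
  -- gives f x y ∙ ε; later uses of the unit law on singletons remove this summand.
  extend : (X → Y → Carrier) → List (X × Y) → Carrier
  extend f []            = ε
  extend f ((x , y) ∷ u) = f x y ∙ extend f u

  extend-++ : ∀ f u v → extend f (u ++ v) ≈ extend f u ∙ extend f v
  extend-++ f []            v = sym (identityˡ _)
  extend-++ f ((x , y) ∷ u) v = trans (∙-congˡ (extend-++ f u v)) (sym (assoc _ _ _))

  extend-cong : ∀ {f g} → (∀ x y → f x y ≈ g x y) → ∀ u → extend f u ≈ extend g u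
  extend-cong p []            = refl
  extend-cong p ((x , y) ∷ u) = ∙-cong (p x y) (extend-cong p u)

  extend-ε : ∀ {f} → (∀ x y → f x y ≈ ε) → ∀ u → extend f u ≈ ε
  extend-ε p []            = refl
  extend-ε p ((x , y) ∷ u) = trans (∙-cong (p x y) (extend-ε p u)) (identityˡ ε)

  extend-∙ : ∀ {f g k} → (∀ x y → f x y ≈ g x y ∙ k x y) →
             ∀ u → extend f u ≈ extend g u ∙ extend k u
  extend-∙ p []            = sym (identityˡ ε)
  extend-∙ p ((x , y) ∷ u) = trans (∙-cong (p x y) (extend-∙ p u)) (interchange _ _ _ _)

module _ {B : Semiring ℓ ℓ} (X : RightSemimodule B ℓ ℓ) (Y : LeftSemimodule B ℓ ℓ)
         (Z : CommutativeMonoid ℓ ℓ) where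
  private
    module X = RightSemimodule X
    module Y = LeftSemimodule Y
  open CommutativeMonoid Z

  record IsBalanced (f : X.Carrierᴹ → Y.Carrierᴹ → Carrier) : Set ℓ where
    field
      cong    : ∀ {x x′ y y′} → x X.≈ᴹ x′ → y Y.≈ᴹ y′ → f x y ≈ f x′ y′
      addˡ    : ∀ x x′ y → f (x X.+ᴹ x′) y ≈ f x y ∙ f x′ y
      addʳ    : ∀ x y y′ → f x (y Y.+ᴹ y′) ≈ f x y ∙ f x y′
      zeroˡ   : ∀ y → f X.0ᴹ y ≈ ε
      zeroʳ   : ∀ x → f x Y.0ᴹ ≈ ε
      balance : ∀ x b y → f (x X.*ᵣ b) y ≈ f x (b Y.*ₗ y)

  -- The existence half of the universal property of the tensor product, by induction on the
  -- congruence: each generating relation becomes a field of `IsBalanced` or a law of the monoid.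
  extend-resp : ∀ {f} → IsBalanced f → ∀ {u v} → TensorEq X Y u v → extend Z f u ≈ extend Z f v
  extend-resp {f} f-balanced = go
    where
    open IsBalanced f-balanced

    go : ∀ {u v} → TensorEq X Y u v → extend Z f u ≈ extend Z f v
    go ≋-refl = refl
    go (≋-sym p) = sym (go p)
    go (≋-trans p q) = trans (go p) (go q)
    go (++-cong {u} {u′} {v} {v′} p q) =
      trans (extend-++ Z f u v) (trans (∙-cong (go p) (go q)) (sym (extend-++ Z f u′ v′)))
    go (++-comm u v) =
      trans (extend-++ Z f u v) (trans (comm _ _) (sym (extend-++ Z f v u)))
    go (⊗-cong p q) = ∙-congʳ (cong p q)
    go (⊗-addˡ x x′ y) = trans (∙-congʳ (addˡ x x′ y)) (assoc _ _ _)
    go (⊗-addʳ x y y′) = trans (∙-congʳ (addʳ x y y′)) (assoc _ _ _)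
    go (⊗-zeroˡ y) = trans (identityʳ _) (zeroˡ y)
    go (⊗-zeroʳ x) = trans (identityʳ _) (zeroʳ x)
    go (⊗-balance x b y) = ∙-congʳ (balance x b y)

-- Evaluation and coevaluation for an isomorphism M ⊗ N ≅ A

module Pairing {A B : Semiring ℓ ℓ} (M : Bisemimodule A B ℓ ℓ) (N : Bisemimodule B A ℓ ℓ)
               (φ : M ⊗ N ≅ tensorUnit {R = A}) where
  private
    module A = Semiring A
    module M = Bisemimodule M
    module N = Bisemimodule N
    module M⊗N = Bisemimodule (M ⊗ N)
    open BisemimoduleMorphisms M⊗N.rawBisemimodule
           (Bisemimodule.rawBisemimodule (tensorUnit {R = A}))

  pair : FormalSum M.rightSemimodule N.leftSemimodule → A.Carrier
  pair = proj₁ φ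

  module pair = IsBisemimoduleIsomorphism (proj₂ φ)

  ⟨_,_⟩ : M.Carrierᴹ → N.Carrierᴹ → A.Carrier
  ⟨ m , n ⟩ = pair [ m , n ]

  pairing-cong : ∀ {m m′ n n′} → m M.≈ᴹ m′ → n N.≈ᴹ n′ → ⟨ m , n ⟩ A.≈ ⟨ m′ , n′ ⟩
  pairing-cong p q = pair.⟦⟧-cong (⊗-cong p q)

  pairing-addˡ : ∀ m m′ n → ⟨ m M.+ᴹ m′ , n ⟩ A.≈ ⟨ m , n ⟩ A.+ ⟨ m′ , n ⟩
  pairing-addˡ m m′ n = A.trans (pair.⟦⟧-cong (⊗-addˡ m m′ n)) (pair.+ᴹ-homo [ m , n ] [ m′ , n ])

  pairing-addʳ : ∀ m n n′ → ⟨ m , n N.+ᴹ n′ ⟩ A.≈ ⟨ m , n ⟩ A.+ ⟨ m , n′ ⟩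
  pairing-addʳ m n n′ = A.trans (pair.⟦⟧-cong (⊗-addʳ m n n′)) (pair.+ᴹ-homo [ m , n ] [ m , n′ ])

  pairing-zeroˡ : ∀ n → ⟨ M.0ᴹ , n ⟩ A.≈ A.0#
  pairing-zeroˡ n = A.trans (pair.⟦⟧-cong (⊗-zeroˡ n)) pair.0ᴹ-homo

  pairing-zeroʳ : ∀ m → ⟨ m , N.0ᴹ ⟩ A.≈ A.0#
  pairing-zeroʳ m = A.trans (pair.⟦⟧-cong (⊗-zeroʳ m)) pair.0ᴹ-homo

  pairing-balance : ∀ m b n → ⟨ m M.*ᵣ b , n ⟩ A.≈ ⟨ m , b N.*ₗ n ⟩
  pairing-balance m b n = pair.⟦⟧-cong (⊗-balance m b n)

  pairing-*ₗ : ∀ a m n → ⟨ a M.*ₗ m , n ⟩ A.≈ a A.* ⟨ m , n ⟩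
  pairing-*ₗ a m n = pair.*ₗ-homo a [ m , n ]

  pairing-*ᵣ : ∀ a m n → ⟨ m , n N.*ᵣ a ⟩ A.≈ ⟨ m , n ⟩ A.* a
  pairing-*ᵣ a m n = pair.*ᵣ-homo a [ m , n ]

  -- Surjectivity supplies 1 = Σ ⟨ mⱼ , nⱼ ⟩; the pairs mⱼ, nⱼ act as a dual basis.
  unit : FormalSum M.rightSemimodule N.leftSemimodule
  unit = proj₁ (pair.surjective A.1#)

  pair-unit : pair unit A.≈ A.1#
  pair-unit = proj₂ (pair.surjective A.1#) ≋-refl

  -- Both sides have the same image ⟨ m , n ⟩ under the injective map `pair`. In sums: Σ mⱼ ⊗ nⱼ ⟨ m
  -- , n ⟩ = m ⊗ n.
  unit-absorbs : ∀ m n → unit M⊗N.*ᵣ ⟨ m , n ⟩ M⊗N.≈ᴹ [ m , n ]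
  unit-absorbs m n = pair.injective (begin
    pair (unit M⊗N.*ᵣ ⟨ m , n ⟩)   ≈⟨ pair.*ᵣ-homo ⟨ m , n ⟩ unit ⟩
    pair unit A.* ⟨ m , n ⟩        ≈⟨ A.*-congʳ pair-unit ⟩
    A.1# A.* ⟨ m , n ⟩             ≈⟨ A.*-identityˡ _ ⟩
    ⟨ m , n ⟩                      ∎)
    where open ≈-Reasoning A.setoid

  module Evaluation (P : LeftSemimodule A ℓ ℓ) where
    private
      module P = LeftSemimodule P
      module N⊗P = LeftSemimodule (N ⊗ₗ P)
      module M⊗N⊗P = LeftSemimodule (M ⊗ₗ (N ⊗ₗ P))
      P₊ = P.+ᴹ-commutativeMonoid

    -- Evaluation on M ⊗ (N ⊗ P) proceeds in two stages, first with m fixed, so that each of the two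
    -- nested formal sums is handled by its own use of `extend-resp`.
    contract : M.Carrierᴹ → N⊗P.Carrierᴹ → P.Carrierᴹ
    contract m = extend P₊ (λ n p → ⟨ m , n ⟩ P.*ₗ p)

    contract-balanced : ∀ m → IsBalanced N.rightSemimodule P P₊ (λ n p → ⟨ m , n ⟩ P.*ₗ p)
    contract-balanced m = record
      { cong    = λ p q → P.*ₗ-cong (pairing-cong M.≈ᴹ-refl p) q
      ; addˡ    = λ n n′ p → P.≈ᴹ-trans (P.*ₗ-congʳ (pairing-addʳ m n n′)) (P.*ₗ-distribʳ p _ _)
      ; addʳ    = λ n p p′ → P.*ₗ-distribˡ _ p p′
      ; zeroˡ   = λ p → P.≈ᴹ-trans (P.*ₗ-congʳ (pairing-zeroʳ m)) (P.*ₗ-zeroˡ p)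
      ; zeroʳ   = λ n → P.*ₗ-zeroʳ _
      ; balance = λ n a p → P.≈ᴹ-trans (P.*ₗ-congʳ (pairing-*ᵣ a m n)) (P.*ₗ-assoc _ a p) }

    contract-cong : ∀ {m m′ u v} → m M.≈ᴹ m′ → u N⊗P.≈ᴹ v → contract m u P.≈ᴹ contract m′ v
    contract-cong {m} {m′} {u} {v} p q =
      P.≈ᴹ-trans (extend-resp _ _ _ (contract-balanced m) q)
                 (extend-cong P₊ (λ n q → P.*ₗ-congʳ {q} (pairing-cong p (N.≈ᴹ-refl {n}))) v)

    contract-++ : ∀ m u v → contract m (u ++ v) P.≈ᴹ contract m u P.+ᴹ contract m v
    contract-++ m = extend-++ P₊ (λ n p → ⟨ m , n ⟩ P.*ₗ p)

    contract-*ₗ : ∀ a m v → contract (a M.*ₗ m) v P.≈ᴹ a P.*ₗ contract m v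
    contract-*ₗ a m [] = P.≈ᴹ-sym (P.*ₗ-zeroʳ a)
    contract-*ₗ a m ((n , p) ∷ v) = P.≈ᴹ-trans
      (P.+ᴹ-cong (P.≈ᴹ-trans (P.*ₗ-congʳ (pairing-*ₗ a m n)) (P.*ₗ-assoc a _ p))
                 (contract-*ₗ a m v))
      (P.≈ᴹ-sym (P.*ₗ-distribˡ a _ _))

    contract-balance : ∀ m b v → contract (m M.*ᵣ b) v P.≈ᴹ contract m (b N⊗P.*ₗ v)
    contract-balance m b [] = P.≈ᴹ-refl
    contract-balance m b ((n , p) ∷ v) =
      P.+ᴹ-cong (P.*ₗ-congʳ (pairing-balance m b n)) (contract-balance m b v)

    evaluate : M⊗N⊗P.Carrierᴹ → P.Carrierᴹ
    evaluate = extend P₊ contract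

    evaluate-balanced : IsBalanced M.rightSemimodule (N ⊗ₗ P) P₊ contract
    evaluate-balanced = record
      { cong    = contract-cong
      ; addˡ    = λ m m′ → extend-∙ P₊ (λ n p →
                    P.≈ᴹ-trans (P.*ₗ-congʳ (pairing-addˡ m m′ n)) (P.*ₗ-distribʳ p _ _))
      ; addʳ    = contract-++
      ; zeroˡ   = extend-ε P₊ (λ n p →
                    P.≈ᴹ-trans (P.*ₗ-congʳ (pairing-zeroˡ n)) (P.*ₗ-zeroˡ p))
      ; zeroʳ   = λ _ → P.≈ᴹ-refl
      ; balance = contract-balance }

    evaluate-*ₗ : ∀ a u → evaluate (a M⊗N⊗P.*ₗ u) P.≈ᴹ a P.*ₗ evaluate u
    evaluate-*ₗ a [] = P.≈ᴹ-sym (P.*ₗ-zeroʳ a)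
    evaluate-*ₗ a ((m , v) ∷ u) = P.≈ᴹ-trans
      (P.+ᴹ-cong (contract-*ₗ a m v) (evaluate-*ₗ a u)) (P.≈ᴹ-sym (P.*ₗ-distribˡ a _ _))

    evaluateHom : LeftHom (M ⊗ₗ (N ⊗ₗ P)) P
    evaluateHom = record
      { ⟦_⟧ = evaluate
      ; isHom = record
        { +ᴹ-isMonoidHomomorphism = record
          { isMagmaHomomorphism = record
            { isRelHomomorphism = record { cong = extend-resp _ _ _ evaluate-balanced }
            ; homo = extend-++ P₊ contract }
          ; ε-homo = P.≈ᴹ-refl }
        ; *ₗ-homo = evaluate-*ₗ } }

    insert : FormalSum M.rightSemimodule N.leftSemimodule → P.Carrierᴹ → M⊗N⊗P.Carrierᴹ
    insert u p = mapSum idᶠ (λ n → [ n , p ]) u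

    -- For fixed p, n ↦ n ⊗ p is a homomorphism of left modules from N to N ⊗ P, and `insert`
    -- tensors it with the identity of M.
    insert-resp : ∀ p {u v} → u M⊗N.≈ᴹ v → insert u p M⊗N⊗P.≈ᴹ insert v p
    insert-resp p = mapSum-resp (idʳ M.rightSemimodule) record
      { ⟦_⟧ = λ n → [ n , p ]
      ; isHom = record
        { +ᴹ-isMonoidHomomorphism = record
          { isMagmaHomomorphism = record
            { isRelHomomorphism = record { cong = λ q → ⊗-cong q P.≈ᴹ-refl }
            ; homo = λ n n′ → ⊗-addˡ n n′ p }
          ; ε-homo = ⊗-zeroˡ p }
        ; *ₗ-homo = λ _ _ → ≋-refl } }

    insert-cong : ∀ u {p p′} → p P.≈ᴹ p′ → insert u p M⊗N⊗P.≈ᴹ insert u p′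
    insert-cong [] q = ≋-refl
    insert-cong ((m , n) ∷ u) q =
      ++-cong (⊗-cong M.≈ᴹ-refl (⊗-cong N.≈ᴹ-refl q)) (insert-cong u q)

    insert-+ : ∀ u p p′ → insert u (p P.+ᴹ p′) M⊗N⊗P.≈ᴹ insert u p M⊗N⊗P.+ᴹ insert u p′
    insert-+ [] p p′ = ≋-refl
    insert-+ ((m , n) ∷ u) p p′ = ≋-trans
      (++-cong (≋-trans (⊗-cong M.≈ᴹ-refl (⊗-addʳ n p p′)) (⊗-addʳ m [ n , p ] [ n , p′ ]))
               (insert-+ u p p′))
      (interchange [ m , [ n , p ] ] [ m , [ n , p′ ] ] (insert u p) (insert u p′))
      where
      open CommutativeSemigroupProperties
        (CommutativeMonoid.commutativeSemigroup M⊗N⊗P.+ᴹ-commutativeMonoid)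

    insert-0 : ∀ u → insert u P.0ᴹ M⊗N⊗P.≈ᴹ []
    insert-0 [] = ≋-refl
    insert-0 ((m , n) ∷ u) =
      ++-cong (≋-trans (⊗-cong M.≈ᴹ-refl (⊗-zeroʳ n)) (⊗-zeroʳ m)) (insert-0 u)

    insert-*ᵣ : ∀ u a p → insert u (a P.*ₗ p) M⊗N⊗P.≈ᴹ insert (u M⊗N.*ᵣ a) p
    insert-*ᵣ [] a p = ≋-refl
    insert-*ᵣ ((m , n) ∷ u) a p =
      ++-cong (⊗-cong M.≈ᴹ-refl (≋-sym (⊗-balance n a p))) (insert-*ᵣ u a p)

    evaluate-insert : ∀ u p → evaluate (insert u p) P.≈ᴹ pair u P.*ₗ p
    evaluate-insert [] p = P.≈ᴹ-sym (P.≈ᴹ-trans (P.*ₗ-congʳ pair.0ᴹ-homo) (P.*ₗ-zeroˡ p))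
    evaluate-insert ((m , n) ∷ u) p = begin
      (⟨ m , n ⟩ P.*ₗ p P.+ᴹ P.0ᴹ) P.+ᴹ evaluate (insert u p)
        ≈⟨ P.+ᴹ-cong (P.+ᴹ-identityʳ _) (evaluate-insert u p) ⟩
      ⟨ m , n ⟩ P.*ₗ p P.+ᴹ pair u P.*ₗ p
        ≈⟨ P.*ₗ-distribʳ p _ _ ⟨
      (⟨ m , n ⟩ A.+ pair u) P.*ₗ p
        ≈⟨ P.*ₗ-congʳ (pair.+ᴹ-homo [ m , n ] u) ⟨
      pair ((m , n) ∷ u) P.*ₗ p
        ∎
      where open ≈-Reasoning P.≈ᴹ-setoid

    coevaluate : P.Carrierᴹ → M⊗N⊗P.Carrierᴹ
    coevaluate = insert unit

    evaluate-coevaluate : ∀ p → evaluate (coevaluate p) P.≈ᴹ p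
    evaluate-coevaluate p = P.≈ᴹ-trans (evaluate-insert unit p)
      (P.≈ᴹ-trans (P.*ₗ-congʳ pair-unit) (P.*ₗ-identityˡ p))

    -- Additivity reduces this to v = n ⊗ p. There the scalar ⟨ m , n ⟩ moves from p across the
    -- inner tensor onto the nⱼ, and `unit-absorbs` collapses Σ mⱼ ⊗ nⱼ ⟨ m , n ⟩ to m ⊗ n.
    coevaluate-contract : ∀ m v → coevaluate (contract m v) M⊗N⊗P.≈ᴹ [ m , v ]
    coevaluate-contract m [] = ≋-trans (insert-0 unit) (≋-sym (⊗-zeroʳ m))
    coevaluate-contract m ((n , p) ∷ v) = begin
      coevaluate (⟨ m , n ⟩ P.*ₗ p P.+ᴹ contract m v)
        ≈⟨ insert-+ unit _ _ ⟩
      coevaluate (⟨ m , n ⟩ P.*ₗ p) ++ coevaluate (contract m v)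
        ≈⟨ ++-cong (≋-trans (insert-*ᵣ unit _ p) (insert-resp p (unit-absorbs m n)))
                   (coevaluate-contract m v) ⟩
      (m , [ n , p ]) ∷ (m , v) ∷ []
        ≈⟨ ⊗-addʳ m [ n , p ] v ⟨
      [ m , (n , p) ∷ v ]
        ∎
      where open ≈-Reasoning M⊗N⊗P.≈ᴹ-setoid

    coevaluate-evaluate : ∀ u → coevaluate (evaluate u) M⊗N⊗P.≈ᴹ u
    coevaluate-evaluate [] = insert-0 unit
    coevaluate-evaluate ((m , v) ∷ u) = ≋-trans (insert-+ unit _ _)
      (++-cong (coevaluate-contract m v) (coevaluate-evaluate u))

    -- Linearity is transported from `evaluate`, whose two-sided inverse `coevaluate` is.
    coevaluate-*ₗ : ∀ a p → coevaluate (a P.*ₗ p) M⊗N⊗P.≈ᴹ a M⊗N⊗P.*ₗ coevaluate p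
    coevaluate-*ₗ a p = begin
      coevaluate (a P.*ₗ p)
        ≈⟨ insert-cong unit (P.*ₗ-congˡ (evaluate-coevaluate p)) ⟨
      coevaluate (a P.*ₗ evaluate (coevaluate p))
        ≈⟨ insert-cong unit (evaluate-*ₗ a (coevaluate p)) ⟨
      coevaluate (evaluate (a M⊗N⊗P.*ₗ coevaluate p))
        ≈⟨ coevaluate-evaluate _ ⟩
      a M⊗N⊗P.*ₗ coevaluate p
        ∎
      where open ≈-Reasoning M⊗N⊗P.≈ᴹ-setoid

    coevaluateHom : LeftHom P (M ⊗ₗ (N ⊗ₗ P))
    coevaluateHom = record
      { ⟦_⟧ = coevaluate
      ; isHom = record
        { +ᴹ-isMonoidHomomorphism = record
          { isMagmaHomomorphism = record
            { isRelHomomorphism = record { cong = insert-cong unit }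
            ; homo = insert-+ unit }
          ; ε-homo = insert-0 unit }
        ; *ₗ-homo = coevaluate-*ₗ } }

  module _ {P Q : LeftSemimodule A ℓ ℓ} (f : LeftHom P Q) where
    private
      module f = LeftHom f
      module M⊗N⊗Q = LeftSemimodule (M ⊗ₗ (N ⊗ₗ Q))
    open Evaluation

    coevaluate-natural : ∀ p → coevaluate Q (f.⟦ p ⟧) M⊗N⊗Q.≈ᴹ
                               LeftHom.⟦_⟧ (M ⊗₁ (N ⊗₁ f)) (coevaluate P p)
    coevaluate-natural p = go unit
      where
      go : ∀ u → insert Q u (f.⟦ p ⟧) M⊗N⊗Q.≈ᴹ LeftHom.⟦_⟧ (M ⊗₁ (N ⊗₁ f)) (insert P u p)
      go [] = ≋-refl
      go ((m , n) ∷ u) = ++-cong ≋-refl (go u)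

  module BimoduleEvaluation {C : Semiring ℓ ℓ} (P : Bisemimodule A C ℓ ℓ) where
    private
      module P = Bisemimodule P
      module N⊗P = Bisemimodule (N ⊗ P)
      module M⊗N⊗P = Bisemimodule (M ⊗ (N ⊗ P))
    open Evaluation P.leftSemimodule

    contract-*ᵣ : ∀ m v c → contract m (v N⊗P.*ᵣ c) P.≈ᴹ contract m v P.*ᵣ c
    contract-*ᵣ m [] c = P.≈ᴹ-sym (P.*ᵣ-zeroˡ c)
    contract-*ᵣ m ((n , p) ∷ v) c = P.≈ᴹ-trans
      (P.+ᴹ-cong (P.≈ᴹ-sym (P.*ₗ-*ᵣ-assoc _ p c)) (contract-*ᵣ m v c))
      (P.≈ᴹ-sym (P.*ᵣ-distribʳ c _ _))

    evaluate-*ᵣ : ∀ u c → evaluate (u M⊗N⊗P.*ᵣ c) P.≈ᴹ evaluate u P.*ᵣ c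
    evaluate-*ᵣ [] c = P.≈ᴹ-sym (P.*ᵣ-zeroˡ c)
    evaluate-*ᵣ ((m , v) ∷ u) c = P.≈ᴹ-trans
      (P.+ᴹ-cong (contract-*ᵣ m v c) (evaluate-*ᵣ u c)) (P.≈ᴹ-sym (P.*ᵣ-distribʳ c _ _))

    coevaluate-*ᵣ : ∀ p c → coevaluate (p P.*ᵣ c) M⊗N⊗P.≈ᴹ coevaluate p M⊗N⊗P.*ᵣ c
    coevaluate-*ᵣ p c = go unit
      where
      go : ∀ u → insert u (p P.*ᵣ c) M⊗N⊗P.≈ᴹ insert u p M⊗N⊗P.*ᵣ c
      go [] = ≋-refl
      go ((m , n) ∷ u) = ++-cong ≋-refl (go u)

    evaluateBiHom : BiHom (M ⊗ (N ⊗ P)) P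
    evaluateBiHom = record
      { ⟦_⟧ = evaluate
      ; isHom = record
        { +ᴹ-isMonoidHomomorphism = LeftHom.+ᴹ-isMonoidHomomorphism evaluateHom
        ; *ₗ-homo = evaluate-*ₗ
        ; *ᵣ-homo = λ c u → evaluate-*ᵣ u c } }

    coevaluateBiHom : BiHom P (M ⊗ (N ⊗ P))
    coevaluateBiHom = record
      { ⟦_⟧ = coevaluate
      ; isHom = record
        { +ᴹ-isMonoidHomomorphism = LeftHom.+ᴹ-isMonoidHomomorphism coevaluateHom
        ; *ₗ-homo = coevaluate-*ₗ
        ; *ᵣ-homo = λ c p → coevaluate-*ᵣ p c } }

-- Φ and Ψ need not be compatible, that is, Ψ⟨ n , m ⟩ n′ ≉ n Φ⟨ m , n′ ⟩ in general; the
-- two sides differ by the automorphism `twist` of N.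
module Morita {A B : Semiring ℓ ℓ} (M : Bisemimodule A B ℓ ℓ) (N : Bisemimodule B A ℓ ℓ)
              (φ : M ⊗ N ≅ tensorUnit {R = A}) (ψ : N ⊗ M ≅ tensorUnit {R = B}) where
  private
    module A = Semiring A
    module B = Semiring B
    module M = Bisemimodule M
    module N = Bisemimodule N
    module M⊗N = Bisemimodule (M ⊗ N)
  module Φ = Pairing M N φ
  module Ψ = Pairing N M ψ

  -- In sums, twist n = Σ Ψ⟨ n , mⱼ ⟩ nⱼ, where Σ Φ⟨ mⱼ , nⱼ ⟩ = 1; for compatible pairings this is
  -- n.
  twist : N.Carrierᴹ → N.Carrierᴹ
  twist n = Ψ.Evaluation.contract N.leftSemimodule n Φ.unit

  -- Contract both sides of m ⊗ n′ = Σ mⱼ ⊗ nⱼ Φ⟨ m , n′ ⟩ with n; the scalar comes out on the right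
  -- because contraction is right linear.
  twist-Φ : ∀ n m n′ → Ψ.⟨ n , m ⟩ N.*ₗ n′ N.≈ᴹ twist n N.*ᵣ Φ.⟨ m , n′ ⟩
  twist-Φ n m n′ = begin
    Ψ.⟨ n , m ⟩ N.*ₗ n′                    ≈⟨ N.+ᴹ-identityʳ _ ⟨
    contract n [ m , n′ ]                  ≈⟨ contract-cong N.≈ᴹ-refl (Φ.unit-absorbs m n′) ⟨
    contract n (Φ.unit M⊗N.*ᵣ Φ.⟨ m , n′ ⟩)  ≈⟨ contract-*ᵣ n Φ.unit _ ⟩
    twist n N.*ᵣ Φ.⟨ m , n′ ⟩              ∎
    where
    open Ψ.Evaluation N.leftSemimodule
    open Ψ.BimoduleEvaluation N
    open ≈-Reasoning N.≈ᴹ-setoid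

  private
    *ᵣΨ-balanced : ∀ m → IsBalanced M.rightSemimodule N.leftSemimodule M.+ᴹ-commutativeMonoid
                                    (λ m′ n → m′ M.*ᵣ Ψ.⟨ n , m ⟩)
    *ᵣΨ-balanced m = record
      { cong    = λ p q → M.*ᵣ-cong p (Ψ.pairing-cong q M.≈ᴹ-refl)
      ; addˡ    = λ m′ m″ n → M.*ᵣ-distribʳ _ m′ m″
      ; addʳ    = λ m′ n n′ → M.≈ᴹ-trans (M.*ᵣ-congˡ (Ψ.pairing-addˡ n n′ m)) (M.*ᵣ-distribˡ m′ _ _)
      ; zeroˡ   = λ n → M.*ᵣ-zeroˡ _
      ; zeroʳ   = λ m′ → M.≈ᴹ-trans (M.*ᵣ-congˡ (Ψ.pairing-zeroˡ m)) (M.*ᵣ-zeroʳ m′)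
      ; balance = λ m′ b n → M.≈ᴹ-trans (M.*ᵣ-assoc m′ b _)
                                        (M.*ᵣ-congˡ (B.sym (Ψ.pairing-*ₗ b n m))) }

  -- By injectivity of `Φ.pair`, the hypothesis says m ⊗ n = m′ ⊗ n for all n. The balanced map a ⊗
  -- n ↦ a Ψ⟨ n , m″ ⟩ then shows that m and m′ agree after multiplication by every Ψ⟨ n , m″ ⟩, and
  -- 1 is a sum of these.
  Φ-separates : ∀ {m m′} → (∀ n → Φ.⟨ m , n ⟩ A.≈ Φ.⟨ m′ , n ⟩) → m M.≈ᴹ m′
  Φ-separates {m} {m′} eq = begin
    m                        ≈⟨ M.*ᵣ-identityʳ m ⟨
    m M.*ᵣ B.1#              ≈⟨ M.*ᵣ-congˡ Ψ.pair-unit ⟨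
    m M.*ᵣ Ψ.pair Ψ.unit     ≈⟨ on-pair Ψ.unit ⟩
    m′ M.*ᵣ Ψ.pair Ψ.unit    ≈⟨ M.*ᵣ-congˡ Ψ.pair-unit ⟩
    m′ M.*ᵣ B.1#             ≈⟨ M.*ᵣ-identityʳ m′ ⟩
    m′                       ∎
    where
    open ≈-Reasoning M.≈ᴹ-setoid

    on-generator : ∀ n m″ → m M.*ᵣ Ψ.⟨ n , m″ ⟩ M.≈ᴹ m′ M.*ᵣ Ψ.⟨ n , m″ ⟩
    on-generator n m″ = M.≈ᴹ-trans (M.≈ᴹ-sym (M.+ᴹ-identityʳ _)) (M.≈ᴹ-trans
      (extend-resp _ _ _ (*ᵣΨ-balanced m″) (Φ.pair.injective {[ m , n ]} {[ m′ , n ]} (eq n)))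
      (M.+ᴹ-identityʳ _))

    on-pair : ∀ v → m M.*ᵣ Ψ.pair v M.≈ᴹ m′ M.*ᵣ Ψ.pair v
    on-pair [] = begin
      m M.*ᵣ Ψ.pair []    ≈⟨ M.*ᵣ-congˡ Ψ.pair.0ᴹ-homo ⟩
      m M.*ᵣ B.0#         ≈⟨ M.*ᵣ-zeroʳ m ⟩
      M.0ᴹ                ≈⟨ M.*ᵣ-zeroʳ m′ ⟨
      m′ M.*ᵣ B.0#        ≈⟨ M.*ᵣ-congˡ Ψ.pair.0ᴹ-homo ⟨
      m′ M.*ᵣ Ψ.pair []   ∎
    on-pair ((n , m″) ∷ v) = begin
      m M.*ᵣ Ψ.pair ((n , m″) ∷ v)
        ≈⟨ M.*ᵣ-congˡ (Ψ.pair.+ᴹ-homo [ n , m″ ] v) ⟩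
      m M.*ᵣ (Ψ.⟨ n , m″ ⟩ B.+ Ψ.pair v)
        ≈⟨ M.*ᵣ-distribˡ m _ _ ⟩
      m M.*ᵣ Ψ.⟨ n , m″ ⟩ M.+ᴹ m M.*ᵣ Ψ.pair v
        ≈⟨ M.+ᴹ-cong (on-generator n m″) (on-pair v) ⟩
      m′ M.*ᵣ Ψ.⟨ n , m″ ⟩ M.+ᴹ m′ M.*ᵣ Ψ.pair v
        ≈⟨ M.*ᵣ-distribˡ m′ _ _ ⟨
      m′ M.*ᵣ (Ψ.⟨ n , m″ ⟩ B.+ Ψ.pair v)
        ≈⟨ M.*ᵣ-congˡ (Ψ.pair.+ᴹ-homo [ n , m″ ] v) ⟨
      m′ M.*ᵣ Ψ.pair ((n , m″) ∷ v)
        ∎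

  -- The counterpart of `twist-Φ` for M. Paired with an arbitrary n′, both sides become Φ⟨ m , twist
  -- n ⟩ Φ⟨ m′ , n′ ⟩, and `Φ-separates` removes n′.
  Φ-twist : ∀ m n m′ → m M.*ᵣ Ψ.⟨ n , m′ ⟩ M.≈ᴹ Φ.⟨ m , twist n ⟩ M.*ₗ m′
  Φ-twist m n m′ = Φ-separates λ n′ → begin
    Φ.⟨ m M.*ᵣ Ψ.⟨ n , m′ ⟩ , n′ ⟩              ≈⟨ Φ.pairing-balance m _ n′ ⟩
    Φ.⟨ m , Ψ.⟨ n , m′ ⟩ N.*ₗ n′ ⟩              ≈⟨ Φ.pairing-cong M.≈ᴹ-refl (twist-Φ n m′ n′) ⟩
    Φ.⟨ m , twist n N.*ᵣ Φ.⟨ m′ , n′ ⟩ ⟩        ≈⟨ Φ.pairing-*ᵣ _ m (twist n) ⟩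
    Φ.⟨ m , twist n ⟩ A.* Φ.⟨ m′ , n′ ⟩         ≈⟨ Φ.pairing-*ₗ _ m′ n′ ⟨
    Φ.⟨ Φ.⟨ m , twist n ⟩ M.*ₗ m′ , n′ ⟩        ∎
    where open ≈-Reasoning A.setoid

  -- `Φ-twist` turns the second factor, acting on m, into a scalar of A, which balance moves to n. A
  -- product of two pairings is thus one pairing, which keeps the powers of Ψ⟨ x , m ⟩ under
  -- control.
  Ψ-* : ∀ n m n′ m′ → Ψ.⟨ n , m ⟩ B.* Ψ.⟨ n′ , m′ ⟩ B.≈ Ψ.⟨ n N.*ᵣ Φ.⟨ m , twist n′ ⟩ , m′ ⟩
  Ψ-* n m n′ m′ = begin
    Ψ.⟨ n , m ⟩ B.* Ψ.⟨ n′ , m′ ⟩               ≈⟨ Ψ.pairing-*ᵣ _ n m ⟨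
    Ψ.⟨ n , m M.*ᵣ Ψ.⟨ n′ , m′ ⟩ ⟩              ≈⟨ Ψ.pairing-cong N.≈ᴹ-refl (Φ-twist m n′ m′) ⟩
    Ψ.⟨ n , Φ.⟨ m , twist n′ ⟩ M.*ₗ m′ ⟩        ≈⟨ Ψ.pairing-balance n _ m′ ⟨
    Ψ.⟨ n N.*ᵣ Φ.⟨ m , twist n′ ⟩ , m′ ⟩        ∎
    where open ≈-Reasoning B.setoid

  module _ (P : LeftSemimodule A ℓ ℓ) where
    private
      module P = LeftSemimodule P
      module N⊗P = LeftSemimodule (N ⊗ₗ P)
    open Φ.Evaluation P

    -- By `twist-Φ` termwise, with the scalars Φ⟨ m , n′ ⟩ moved across the tensor onto p. A single
    -- pairing therefore acts on N ⊗ P as a rank-one operator factoring through P.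
    Ψ-action : ∀ n m v → Ψ.⟨ n , m ⟩ N⊗P.*ₗ v N⊗P.≈ᴹ [ twist n , contract m v ]
    Ψ-action n m [] = ≋-sym (⊗-zeroʳ (twist n))
    Ψ-action n m ((n′ , p) ∷ v) = ≋-trans
      (++-cong (≋-trans (⊗-cong (twist-Φ n m n′) P.≈ᴹ-refl) (⊗-balance (twist n) _ p))
               (Ψ-action n m v))
      (≋-sym (⊗-addʳ (twist n) _ _))

    Ψ-action-*ᵣ : ∀ n a m v →
                  Ψ.⟨ n N.*ᵣ a , m ⟩ N⊗P.*ₗ v N⊗P.≈ᴹ [ twist n , a P.*ₗ contract m v ]
    Ψ-action-*ᵣ n a m v = begin
      Ψ.⟨ n N.*ᵣ a , m ⟩ N⊗P.*ₗ v       ≈⟨ N⊗P.*ₗ-congʳ (Ψ.pairing-balance n a m) ⟩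
      Ψ.⟨ n , a M.*ₗ m ⟩ N⊗P.*ₗ v       ≈⟨ Ψ-action n (a M.*ₗ m) v ⟩
      [ twist n , contract (a M.*ₗ m) v ] ≈⟨ ⊗-cong N.≈ᴹ-refl (contract-*ₗ a m v) ⟩
      [ twist n , a P.*ₗ contract m v ] ∎
      where open ≈-Reasoning N⊗P.≈ᴹ-setoid

-- The Kleene axioms for N ⊗ P

module KleeneMorita (K S : KleeneAlgebra ℓ)
                    (M : Bisemimodule (KleeneAlgebra.semiring K) (KleeneAlgebra.semiring S) ℓ ℓ)
                    (N : Bisemimodule (KleeneAlgebra.semiring S) (KleeneAlgebra.semiring K) ℓ ℓ)
                    (φ : M ⊗ N ≅ tensorUnit {R = KleeneAlgebra.semiring K})
                    (ψ : N ⊗ M ≅ tensorUnit {R = KleeneAlgebra.semiring S}) where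
  private
    module K where
      open KleeneAlgebra K hiding (_≤_) public
      open KleeneProperties K public
    module S where
      open KleeneAlgebra S hiding (_≤_) public
      open KleeneProperties S public
    module M = Bisemimodule M
    module N = Bisemimodule N
  open K using () renaming (_⋆ to _⋆ᴷ)
  open S using () renaming (_⋆ to _⋆ˢ)
  open Morita M N φ ψ

  Ψ-monoˡ : ∀ n m {a b} → a K.≤ b → Ψ.⟨ n N.*ᵣ a , m ⟩ S.≤ Ψ.⟨ n N.*ᵣ b , m ⟩
  Ψ-monoˡ n m p = S.trans (S.sym (Ψ.pairing-addˡ _ _ m))
    (Ψ.pairing-cong (N.≈ᴹ-trans (N.≈ᴹ-sym (N.*ᵣ-distribˡ n _ _)) (N.*ᵣ-congˡ p)) M.≈ᴹ-refl)

  -- The n-th power of Ψ⟨ x , m ⟩ is Ψ⟨ x Φ⟨ m , twist x ⟩ⁿ⁻¹ , m ⟩, for n ≥ 1.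
  Ψ-⋆-bound : ∀ x m → Ψ.⟨ x , m ⟩ ⋆ˢ S.≤ S.1# S.+ Ψ.⟨ x N.*ᵣ Φ.⟨ m , twist x ⟩ ⋆ᴷ , m ⟩
  Ψ-⋆-bound x m = S.⋆-leastʳ (S.x≤x∙y _ _) (S.≤-respˡ (S.sym (S.distribʳ y _ _))
    (S.≤-trans (S.∙-lub (S.≤-respˡ (S.sym (S.*-identityˡ y)) y≤z) zy≤z) (S.y≤x∙y _ _)))
    where
    c : K.Carrier
    c = Φ.⟨ m , twist x ⟩

    y z : S.Carrier
    y = Ψ.⟨ x , m ⟩
    z = Ψ.⟨ x N.*ᵣ c ⋆ᴷ , m ⟩

    y≤z : y S.≤ z
    y≤z = S.≤-respˡ (Ψ.pairing-cong (N.*ᵣ-identityʳ x) M.≈ᴹ-refl) (Ψ-monoˡ x m (K.1≤x⋆ c))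

    -- By `Ψ-*`, multiplying by y on the right appends one factor c to c⋆.
    zy≤z : z S.* y S.≤ z
    zy≤z = S.≤-respˡ
      (S.sym (S.trans (Ψ-* _ m x m) (Ψ.pairing-cong (N.*ᵣ-assoc x _ _) M.≈ᴹ-refl)))
      (Ψ-monoˡ x m (K.x⋆*x≤x⋆ c))

  module _ (P : LeftSemimodule K.semiring ℓ ℓ) where
    private
      module P where
        open LeftSemimodule P public
        open LeftAction K P public
      module N⊗P where
        open LeftSemimodule (N ⊗ₗ P) public
        open LeftAction S (N ⊗ₗ P) public
    open Φ.Evaluation P

    contract-mono : ∀ m {u v} → u N⊗P.≤ v → contract m u P.≤ contract m v
    contract-mono m {u} {v} p = P.≈ᴹ-trans (P.≈ᴹ-sym (contract-++ m u v)) (contract-cong M.≈ᴹ-refl p)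

    ⊗-monoʳ : ∀ n {p q} → p P.≤ q → [ n , p ] N⊗P.≤ [ n , q ]
    ⊗-monoʳ n p = ≋-trans (≋-sym (⊗-addʳ n _ _)) (⊗-cong N.≈ᴹ-refl p)

    -- Write 1 in S as a sum of pairings. By `Ψ-action`, u is then the sum of the tensors twist n ⊗
    -- contract m u, likewise v, and tensoring with `twist n` is monotone.
    contract-reflects : ∀ {u v} → (∀ m → contract m u P.≤ contract m v) → u N⊗P.≤ v
    contract-reflects {u} {v} p =
      N⊗P.≤-respˡ (absorb u) (N⊗P.≤-respʳ (absorb v) (on-pair Ψ.unit))
      where
      absorb : ∀ w → Ψ.pair Ψ.unit N⊗P.*ₗ w N⊗P.≈ᴹ w
      absorb w = ≋-trans (N⊗P.*ₗ-congʳ Ψ.pair-unit) (N⊗P.*ₗ-identityˡ w)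

      on-pair : ∀ w → Ψ.pair w N⊗P.*ₗ u N⊗P.≤ Ψ.pair w N⊗P.*ₗ v
      on-pair [] = N⊗P.≤-reflexive (≋-trans (zero u) (≋-sym (zero v)))
        where
        zero : ∀ w → Ψ.pair [] N⊗P.*ₗ w N⊗P.≈ᴹ []
        zero w = ≋-trans (N⊗P.*ₗ-congʳ Ψ.pair.0ᴹ-homo) (N⊗P.*ₗ-zeroˡ w)
      on-pair ((n , m) ∷ w) = N⊗P.≤-respˡ (split u) (N⊗P.≤-respʳ (split v)
        (N⊗P.∙-mono {[ twist n , contract m u ]} (⊗-monoʳ (twist n) (p m)) (on-pair w)))
        where
        split : ∀ q → [ twist n , contract m q ] ++ Ψ.pair w N⊗P.*ₗ q
                      N⊗P.≈ᴹ Ψ.pair ((n , m) ∷ w) N⊗P.*ₗ q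
        split q = ≋-trans (++-cong (≋-sym (Ψ-action P n m q)) ≋-refl)
          (≋-trans (≋-sym (N⊗P.*ₗ-distribʳ q _ _))
                   (N⊗P.*ₗ-congʳ (S.sym (Ψ.pair.+ᴹ-homo [ n , m ] w))))

    module _ (P-kleene : IsLeftKleene K P) where

      -- With w = `contract m v` and c = Φ⟨ m , twist x ⟩, the hypothesis reads twist x ⊗ w ≤ v.
      -- Contracting with m gives c w ≤ w, hence c⋆ w ≤ w in P, and so Ψ⟨ x c⋆ , m ⟩ v = twist x ⊗
      -- c⋆ w ≤ twist x ⊗ w ≤ v. Now `Ψ-⋆-bound` applies.
      Ψ-⋆-decreases : ∀ x m {v} → Ψ.⟨ x , m ⟩ N⊗P.Decreases v → Ψ.⟨ x , m ⟩ ⋆ˢ N⊗P.Decreases v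
      Ψ-⋆-decreases x m {v} yv≤v = N⊗P.decreases-≤ (Ψ-⋆-bound x m)
        (N⊗P.decreases-+ (N⊗P.decreases-1 v)
          (N⊗P.≤-respˡ (≋-sym (Ψ-action-*ᵣ P x _ m v))
            (N⊗P.≤-trans (⊗-monoʳ (twist x) (P-kleene _ _ cw≤w)) xw≤v)))
        where
        w : P.Carrierᴹ
        w = contract m v

        xw≤v : [ twist x , w ] N⊗P.≤ v
        xw≤v = N⊗P.≤-respˡ (Ψ-action P x m v) yv≤v

        cw≤w : Φ.⟨ m , twist x ⟩ P.*ₗ w P.≤ w
        cw≤w = P.≤-respˡ (P.+ᴹ-identityʳ _) (contract-mono m xw≤v)

      -- By (x + y)⋆ ≤ (x⋆ y)⋆ x⋆, and because x⋆ Ψ⟨ n , m ⟩ = Ψ⟨ x⋆ n , m ⟩ is again a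
      -- single pairing.
      pair-⋆-decreases : ∀ u {v} → Ψ.pair u N⊗P.Decreases v → Ψ.pair u ⋆ˢ N⊗P.Decreases v
      pair-⋆-decreases [] {v} _ = N⊗P.decreases-≤
        (S.≤-respˡ (S.⋆-cong (S.sym Ψ.pair.0ᴹ-homo)) S.0⋆≤1) (N⊗P.decreases-1 v)
      pair-⋆-decreases ((n , m) ∷ u) {v} p = N⊗P.decreases-≤
        (S.≤-respˡ (S.⋆-cong (S.sym split)) (S.+-⋆-bound x y))
        (N⊗P.decreases-* x⋆y⋆-decreases x⋆-decreases)
        where
        x y : S.Carrier
        x = Ψ.pair u
        y = Ψ.⟨ n , m ⟩

        split : Ψ.pair ((n , m) ∷ u) S.≈ x S.+ y
        split = S.trans (Ψ.pair.+ᴹ-homo [ n , m ] u) (S.+-comm y x)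

        x⋆-decreases : x ⋆ˢ N⊗P.Decreases v
        x⋆-decreases = pair-⋆-decreases u
          (N⊗P.decreases-≤ (S.≤-respʳ (S.sym split) (S.x≤x∙y x y)) p)

        y-decreases : y N⊗P.Decreases v
        y-decreases = N⊗P.decreases-≤ (S.≤-respʳ (S.sym split) (S.y≤x∙y x y)) p

        x⋆y-decreases : Ψ.⟨ x ⋆ˢ N.*ₗ n , m ⟩ N⊗P.Decreases v
        x⋆y-decreases = N⊗P.decreases-≤ (S.≤-reflexive (Ψ.pairing-*ₗ (x ⋆ˢ) n m))
          (N⊗P.decreases-* x⋆-decreases y-decreases)

        x⋆y⋆-decreases : (x ⋆ˢ S.* y) ⋆ˢ N⊗P.Decreases v
        x⋆y⋆-decreases = N⊗P.decreases-≤
          (S.≤-reflexive (S.⋆-cong (S.sym (Ψ.pairing-*ₗ (x ⋆ˢ) n m))))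
          (Ψ-⋆-decreases (x ⋆ˢ N.*ₗ n) m x⋆y-decreases)

      ⊗ₗ-isLeftKleene : IsLeftKleene S (N ⊗ₗ P)
      ⊗ₗ-isLeftKleene s v p = N⊗P.decreases-≤ (S.≤-reflexive (S.⋆-cong (S.sym pair-u≈s)))
        (pair-⋆-decreases u (N⊗P.decreases-≤ (S.≤-reflexive pair-u≈s) p))
        where
        u : FormalSum N.rightSemimodule M.leftSemimodule
        u = proj₁ (Ψ.pair.surjective s)

        pair-u≈s : Ψ.pair u S.≈ s
        pair-u≈s = proj₂ (Ψ.pair.surjective s) ≋-refl

  module _ (L : KleeneAlgebra ℓ)
           (P : Bisemimodule K.semiring (KleeneAlgebra.semiring L) ℓ ℓ) where
    private
      module P where
        open Bisemimodule P public
        open LeftAction K leftSemimodule public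
    open Φ.BimoduleEvaluation P

    -- Each `contract m` is monotone and commutes with the right action, so the inequality is
    -- carried to P, starred there, and brought back by `contract-reflects`.
    ⊗-isRightKleene : IsRightKleene L P.rightSemimodule →
                      IsRightKleene L (Bisemimodule.rightSemimodule (N ⊗ P))
    ⊗-isRightKleene P-kleene l v vl≤v = contract-reflects P.leftSemimodule λ m →
      P.≤-respˡ (P.≈ᴹ-sym (contract-*ᵣ m v _)) (P-kleene l _
        (P.≤-respˡ (contract-*ᵣ m v l) (contract-mono P.leftSemimodule m vl≤v)))

-- Equivalences of categories

homSetoid : (C : Category o h e) → Category.Obj C → Category.Obj C → Setoid h e
homSetoid C A B = record { isEquivalence = Category.equiv C {A} {B} }

module _ {C : Category o h e} {D : Category o′ h′ e′} (F G : Functor C D) where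
  open Category D
  private
    module F = Functor F
    module G = Functor G
    module D≈ {A} {B} = IsEquivalence (equiv {A} {B})

  -- Units start at the identity functor and counits end there, so reversing an equivalence inverts
  -- both. Naturality of the inverse follows by composing the given square with η⁻¹ at both ends.
  naturalIso-sym : NaturalIsomorphism F G → NaturalIsomorphism G F
  naturalIso-sym α = record
    { η       = η⁻¹
    ; η⁻¹     = η
    ; natural = natural⁻¹
    ; isoˡ    = isoʳ
    ; isoʳ    = isoˡ }
    where
    open NaturalIsomorphism α

    natural⁻¹ : ∀ {A B} (f : Category._⇒_ C A B) → η⁻¹ B ∘ G.F₁ f ≈ F.F₁ f ∘ η⁻¹ A
    natural⁻¹ {A} {B} f = begin
      η⁻¹ B ∘ G.F₁ f                      ≈⟨ ∘-resp-≈ D≈.refl (identityʳ _) ⟨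
      η⁻¹ B ∘ (G.F₁ f ∘ id)              ≈⟨ ∘-resp-≈ D≈.refl (∘-resp-≈ D≈.refl (isoʳ A)) ⟨
      η⁻¹ B ∘ (G.F₁ f ∘ (η A ∘ η⁻¹ A))    ≈⟨ ∘-resp-≈ D≈.refl (assoc _ _ _) ⟨
      η⁻¹ B ∘ ((G.F₁ f ∘ η A) ∘ η⁻¹ A)    ≈⟨ ∘-resp-≈ D≈.refl (∘-resp-≈ (natural f) D≈.refl) ⟨
      η⁻¹ B ∘ ((η B ∘ F.F₁ f) ∘ η⁻¹ A)    ≈⟨ ∘-resp-≈ D≈.refl (assoc _ _ _) ⟩
      η⁻¹ B ∘ (η B ∘ (F.F₁ f ∘ η⁻¹ A))    ≈⟨ assoc _ _ _ ⟨
      (η⁻¹ B ∘ η B) ∘ (F.F₁ f ∘ η⁻¹ A)    ≈⟨ ∘-resp-≈ (isoˡ B) D≈.refl ⟩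
      id ∘ (F.F₁ f ∘ η⁻¹ A)              ≈⟨ identityˡ _ ⟩
      F.F₁ f ∘ η⁻¹ A                      ∎
      where
      open ≈-Reasoning (homSetoid D (G.F₀ A) (F.F₀ B))

module _ {C : Category o h e} {D : Category o′ h′ e′} {E : Category o″ h″ e″}
         (F : Functor C D) (G : Functor D C) (F′ : Functor D E) (G′ : Functor E D) where
  open Category C
  private
    module D = Category D
    module F = Functor F
    module G = Functor G
    module F′ = Functor F′
    module G′ = Functor G′
    module C≈ {A} {B} = IsEquivalence (equiv {A} {B})

  -- This also yields the counit of a composite equivalence: the inverse of a counit is a unit for
  -- the reversed pair of functors.
  unit-trans : NaturalIsomorphism (idFunctor C) (G ∘F F) →
               NaturalIsomorphism (idFunctor D) (G′ ∘F F′) →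
               NaturalIsomorphism (idFunctor C) ((G ∘F G′) ∘F (F′ ∘F F))
  unit-trans α β = record
    { η       = λ A → G.F₁ (β.η (F.F₀ A)) ∘ α.η A
    ; η⁻¹     = λ A → α.η⁻¹ A ∘ G.F₁ (β.η⁻¹ (F.F₀ A))
    ; natural = natural
    ; isoˡ    = λ A → C≈.trans (cancel-middle (G-inverse (β.isoˡ (F.F₀ A)))) (α.isoˡ A)
    ; isoʳ    = λ A → C≈.trans (cancel-middle (α.isoʳ A)) (G-inverse (β.isoʳ (F.F₀ A))) }
    where
    module α = NaturalIsomorphism α
    module β = NaturalIsomorphism β

    cancel-middle : ∀ {X Y Z W} {a : Y ⇒ Z} {f : W ⇒ Y} {g : Y ⇒ W} {b : X ⇒ Y} →
                    f ∘ g ≈ id → (a ∘ f) ∘ (g ∘ b) ≈ a ∘ b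
    cancel-middle p = C≈.trans (assoc _ _ _) (∘-resp-≈ C≈.refl
      (C≈.trans (C≈.sym (assoc _ _ _)) (C≈.trans (∘-resp-≈ p C≈.refl) (identityˡ _))))

    G-inverse : ∀ {X Y} {f : Y D.⇒ X} {g : X D.⇒ Y} → f D.∘ g D.≈ D.id → G.F₁ f ∘ G.F₁ g ≈ id
    G-inverse p = C≈.trans (C≈.sym (G.homomorphism _ _)) (C≈.trans (G.F-resp-≈ p) G.identity)

    natural : ∀ {A B} (f : A ⇒ B) →
              (G.F₁ (β.η (F.F₀ B)) ∘ α.η B) ∘ f ≈
              G.F₁ (G′.F₁ (F′.F₁ (F.F₁ f))) ∘ (G.F₁ (β.η (F.F₀ A)) ∘ α.η A)
    natural {A} {B} f = begin
      (G.F₁ (β.η (F.F₀ B)) ∘ α.η B) ∘ f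
        ≈⟨ assoc _ _ _ ⟩
      G.F₁ (β.η (F.F₀ B)) ∘ (α.η B ∘ f)
        ≈⟨ ∘-resp-≈ C≈.refl (α.natural f) ⟩
      G.F₁ (β.η (F.F₀ B)) ∘ (G.F₁ (F.F₁ f) ∘ α.η A)
        ≈⟨ assoc _ _ _ ⟨
      (G.F₁ (β.η (F.F₀ B)) ∘ G.F₁ (F.F₁ f)) ∘ α.η A
        ≈⟨ ∘-resp-≈ (G.homomorphism _ _) C≈.refl ⟨
      G.F₁ (β.η (F.F₀ B) D.∘ F.F₁ f) ∘ α.η A
        ≈⟨ ∘-resp-≈ (G.F-resp-≈ (β.natural (F.F₁ f))) C≈.refl ⟩
      G.F₁ (G′.F₁ (F′.F₁ (F.F₁ f)) D.∘ β.η (F.F₀ A)) ∘ α.η A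
        ≈⟨ ∘-resp-≈ (G.homomorphism _ _) C≈.refl ⟩
      (G.F₁ (G′.F₁ (F′.F₁ (F.F₁ f))) ∘ G.F₁ (β.η (F.F₀ A))) ∘ α.η A
        ≈⟨ assoc _ _ _ ⟩
      G.F₁ (G′.F₁ (F′.F₁ (F.F₁ f))) ∘ (G.F₁ (β.η (F.F₀ A)) ∘ α.η A)
        ∎
      where open ≈-Reasoning (homSetoid C A (G.F₀ (G′.F₀ (F′.F₀ (F.F₀ B)))))

≃-sym : {C : Category o h e} {D : Category o′ h′ e′} → C ≃ D → D ≃ C
≃-sym {C = C} {D} C≃D = record
  { to            = from
  ; from          = to
  ; isEquivalence = record
    { unit   = naturalIso-sym (to ∘F from) (idFunctor D) counit
    ; counit = naturalIso-sym (idFunctor C) (from ∘F to) unit } }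
  where
  open _≃_ C≃D
  open IsEquivalenceOfCategories isEquivalence

≃-trans : {C : Category o h e} {D : Category o′ h′ e′} {E : Category o″ h″ e″} →
          C ≃ D → D ≃ E → C ≃ E
≃-trans {C = C} {D} {E} C≃D D≃E = record
  { to            = D≃E.to ∘F C≃D.to
  ; from          = C≃D.from ∘F D≃E.from
  ; isEquivalence = record
    { unit   = unit-trans C≃D.to C≃D.from D≃E.to D≃E.from C≃D.unit D≃E.unit
    ; counit = naturalIso-sym (idFunctor E) ((D≃E.to ∘F C≃D.to) ∘F (C≃D.from ∘F D≃E.from))
        (unit-trans D≃E.from D≃E.to C≃D.from C≃D.to
          (naturalIso-sym (D≃E.to ∘F D≃E.from) (idFunctor E) D≃E.counit)
          (naturalIso-sym (C≃D.to ∘F C≃D.from) (idFunctor D) C≃D.counit)) } }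
  where
  module C≃D where
    open _≃_ C≃D public
    open IsEquivalenceOfCategories isEquivalence public
  module D≃E where
    open _≃_ D≃E public
    open IsEquivalenceOfCategories isEquivalence public

-- Opposites

infix 9 _ᵒᵖ
_ᵒᵖ : KleeneAlgebra ℓ → KleeneAlgebra ℓ
K ᵒᵖ = record
  { idempotentSemiring = Op.idempotentSemiring idempotentSemiring
  ; _⋆        = _⋆
  ; ⋆-cong    = ⋆-cong
  ; ⋆-unfoldʳ = ⋆-unfoldˡ
  ; ⋆-unfoldˡ = ⋆-unfoldʳ
  ; ⋆-inductˡ = ⋆-inductʳ
  ; ⋆-inductʳ = ⋆-inductˡ }
  where open KleeneAlgebra K

module _ {A : Semiring ℓ ℓ} where

  rightToLeftᵒᵖ : RightSemimodule A ℓ ℓ → LeftSemimodule (Op.semiring A) ℓ ℓ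
  rightToLeftᵒᵖ P = record
    { _*ₗ_ = flip _*ᵣ_
    ; isLeftSemimodule = record
      { +ᴹ-isCommutativeMonoid = +ᴹ-isCommutativeMonoid
      ; isPreleftSemimodule = record
        { *ₗ-cong      = flip *ᵣ-cong
        ; *ₗ-zeroˡ     = *ᵣ-zeroʳ
        ; *ₗ-distribʳ  = *ᵣ-distribˡ
        ; *ₗ-identityˡ = *ᵣ-identityʳ
        ; *ₗ-assoc     = λ a b x → ≈ᴹ-sym (*ᵣ-assoc x b a)
        ; *ₗ-zeroʳ     = *ᵣ-zeroˡ
        ; *ₗ-distribˡ  = *ᵣ-distribʳ } } }
    where open RightSemimodule P

  -- The way back is a conversion of its own, since `Op.semiring` applied twice returns A only up to
  -- the proofs of its laws.
  leftᵒᵖToRight : LeftSemimodule (Op.semiring A) ℓ ℓ → RightSemimodule A ℓ ℓ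
  leftᵒᵖToRight P = record
    { _*ᵣ_ = flip _*ₗ_
    ; isRightSemimodule = record
      { +ᴹ-isCommutativeMonoid = +ᴹ-isCommutativeMonoid
      ; isPrerightSemimodule = record
        { *ᵣ-cong      = flip *ₗ-cong
        ; *ᵣ-zeroʳ     = *ₗ-zeroˡ
        ; *ᵣ-distribˡ  = *ₗ-distribʳ
        ; *ᵣ-identityʳ = *ₗ-identityˡ
        ; *ᵣ-assoc     = λ x a b → ≈ᴹ-sym (*ₗ-assoc b a x)
        ; *ᵣ-zeroˡ     = *ₗ-zeroʳ
        ; *ᵣ-distribʳ  = *ₗ-distribˡ } } }
    where open LeftSemimodule P

  leftToRightᵒᵖ : LeftSemimodule A ℓ ℓ → RightSemimodule (Op.semiring A) ℓ ℓ
  leftToRightᵒᵖ P = record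
    { _*ᵣ_ = flip _*ₗ_
    ; isRightSemimodule = record
      { +ᴹ-isCommutativeMonoid = +ᴹ-isCommutativeMonoid
      ; isPrerightSemimodule = record
        { *ᵣ-cong      = flip *ₗ-cong
        ; *ᵣ-zeroʳ     = *ₗ-zeroˡ
        ; *ᵣ-distribˡ  = *ₗ-distribʳ
        ; *ᵣ-identityʳ = *ₗ-identityˡ
        ; *ᵣ-assoc     = λ x a b → ≈ᴹ-sym (*ₗ-assoc b a x)
        ; *ᵣ-zeroˡ     = *ₗ-zeroʳ
        ; *ᵣ-distribʳ  = *ₗ-distribˡ } } }
    where open LeftSemimodule P

  rightᵒᵖToLeft : RightSemimodule (Op.semiring A) ℓ ℓ → LeftSemimodule A ℓ ℓ
  rightᵒᵖToLeft P = record
    { _*ₗ_ = flip _*ᵣ_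
    ; isLeftSemimodule = record
      { +ᴹ-isCommutativeMonoid = +ᴹ-isCommutativeMonoid
      ; isPreleftSemimodule = record
        { *ₗ-cong      = flip *ᵣ-cong
        ; *ₗ-zeroˡ     = *ᵣ-zeroʳ
        ; *ₗ-distribʳ  = *ᵣ-distribˡ
        ; *ₗ-identityˡ = *ᵣ-identityʳ
        ; *ₗ-assoc     = λ a b x → ≈ᴹ-sym (*ᵣ-assoc x b a)
        ; *ₗ-zeroʳ     = *ᵣ-zeroˡ
        ; *ₗ-distribˡ  = *ᵣ-distribʳ } } }
    where open RightSemimodule P

module _ {A B : Semiring ℓ ℓ} where

  flipBi : Bisemimodule A B ℓ ℓ → Bisemimodule (Op.semiring B) (Op.semiring A) ℓ ℓ
  flipBi P = record
    { isBisemimodule = record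
      { +ᴹ-isCommutativeMonoid = +ᴹ-isCommutativeMonoid
      ; isPreleftSemimodule    = LeftSemimodule.isPreleftSemimodule (rightToLeftᵒᵖ rightSemimodule)
      ; isPrerightSemimodule   = RightSemimodule.isPrerightSemimodule (leftToRightᵒᵖ leftSemimodule)
      ; *ₗ-*ᵣ-assoc            = λ b x a → ≈ᴹ-sym (*ₗ-*ᵣ-assoc a x b) } }
    where open Bisemimodule P

  unflipBi : Bisemimodule (Op.semiring B) (Op.semiring A) ℓ ℓ → Bisemimodule A B ℓ ℓ
  unflipBi P = record
    { isBisemimodule = record
      { +ᴹ-isCommutativeMonoid = +ᴹ-isCommutativeMonoid
      ; isPreleftSemimodule    = LeftSemimodule.isPreleftSemimodule (rightᵒᵖToLeft rightSemimodule)
      ; isPrerightSemimodule   = RightSemimodule.isPrerightSemimodule (leftᵒᵖToRight leftSemimodule)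
      ; *ₗ-*ᵣ-assoc            = λ a x b → ≈ᴹ-sym (*ₗ-*ᵣ-assoc b x a) } }
    where open Bisemimodule P

module _ (K : KleeneAlgebra ℓ) where
  private
    module Right = RightKleeneModule
    module Left = LeftKleeneModule

  right≃leftᵒᵖ : RightKleeneModules K ≃ LeftKleeneModules (K ᵒᵖ)
  right≃leftᵒᵖ = record
    { to = record
      { F₀ = λ P → record
        { leftSemimodule = rightToLeftᵒᵖ (Right.rightSemimodule P)
        ; isLeftKleene   = Right.isRightKleene P }
      ; F₁ = λ f → record
        { ⟦_⟧   = RightHom.⟦_⟧ f
        ; isHom = record { +ᴹ-isMonoidHomomorphism = RightHom.+ᴹ-isMonoidHomomorphism f
                         ; *ₗ-homo = RightHom.*ᵣ-homo f } }
      ; F-resp-≈     = idᶠ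
      ; identity     = λ {P} _ → Right.≈ᴹ-refl P
      ; homomorphism = λ {_} {_} {P} _ _ _ → Right.≈ᴹ-refl P }
    ; from = record
      { F₀ = λ P → record
        { rightSemimodule = leftᵒᵖToRight (Left.leftSemimodule P)
        ; isRightKleene   = Left.isLeftKleene P }
      ; F₁ = λ f → record
        { ⟦_⟧   = LeftHom.⟦_⟧ f
        ; isHom = record { +ᴹ-isMonoidHomomorphism = LeftHom.+ᴹ-isMonoidHomomorphism f
                         ; *ᵣ-homo = LeftHom.*ₗ-homo f } }
      ; F-resp-≈     = idᶠ
      ; identity     = λ {P} _ → Left.≈ᴹ-refl P
      ; homomorphism = λ {_} {_} {P} _ _ _ → Left.≈ᴹ-refl P }
    ; isEquivalence = record
      { unit = record
        -- The round trip rebuilds P with associativity reversed twice, so P and its image differ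
        -- only in proofs; the identity is repackaged at the new type.
        { η       = λ P → record { RightHom (idʳ (Right.rightSemimodule P)) }
        ; η⁻¹     = λ P → record { RightHom (idʳ (Right.rightSemimodule P)) }
        ; natural = λ {_} {P} _ _ → Right.≈ᴹ-refl P
        ; isoˡ    = λ P _ → Right.≈ᴹ-refl P
        ; isoʳ    = λ P _ → Right.≈ᴹ-refl P }
      ; counit = record
        { η       = λ P → record { LeftHom (idˡ (Left.leftSemimodule P)) }
        ; η⁻¹     = λ P → record { LeftHom (idˡ (Left.leftSemimodule P)) }
        ; natural = λ {_} {P} _ _ → Left.≈ᴹ-refl P
        ; isoˡ    = λ P _ → Left.≈ᴹ-refl P
        ; isoʳ    = λ P _ → Left.≈ᴹ-refl P } } }

module _ (K L : KleeneAlgebra ℓ) where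
  open KleeneBimodule

  flipBimodules : KleeneBimodules K L ≃ KleeneBimodules (L ᵒᵖ) (K ᵒᵖ)
  flipBimodules = record
    { to = record
      { F₀ = λ P → record
        { bisemimodule  = flipBi (bisemimodule P)
        ; isLeftKleene  = isRightKleene P
        ; isRightKleene = isLeftKleene P }
      ; F₁ = λ f → record
        { ⟦_⟧   = BiHom.⟦_⟧ f
        ; isHom = record { +ᴹ-isMonoidHomomorphism = BiHom.+ᴹ-isMonoidHomomorphism f
                         ; *ₗ-homo = BiHom.*ᵣ-homo f ; *ᵣ-homo = BiHom.*ₗ-homo f } }
      ; F-resp-≈     = idᶠ
      ; identity     = λ {P} _ → ≈ᴹ-refl P
      ; homomorphism = λ {_} {_} {P} _ _ _ → ≈ᴹ-refl P }
    ; from = record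
      { F₀ = λ P → record
        { bisemimodule  = unflipBi (bisemimodule P)
        ; isLeftKleene  = isRightKleene P
        ; isRightKleene = isLeftKleene P }
      ; F₁ = λ f → record
        { ⟦_⟧   = BiHom.⟦_⟧ f
        ; isHom = record { +ᴹ-isMonoidHomomorphism = BiHom.+ᴹ-isMonoidHomomorphism f
                         ; *ₗ-homo = BiHom.*ᵣ-homo f ; *ᵣ-homo = BiHom.*ₗ-homo f } }
      ; F-resp-≈     = idᶠ
      ; identity     = λ {P} _ → ≈ᴹ-refl P
      ; homomorphism = λ {_} {_} {P} _ _ _ → ≈ᴹ-refl P }
    ; isEquivalence = record
      { unit = record
        { η       = λ P → record { ⟦_⟧ = idᶠ ; isHom = id-isHom P }
        ; η⁻¹     = λ P → record { ⟦_⟧ = idᶠ ; isHom = id-isHom P }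
        ; natural = λ {_} {P} _ _ → ≈ᴹ-refl P
        ; isoˡ    = λ P _ → ≈ᴹ-refl P
        ; isoʳ    = λ P _ → ≈ᴹ-refl P }
      ; counit = record
        { η       = λ P → record { ⟦_⟧ = idᶠ ; isHom = id-isHom P }
        ; η⁻¹     = λ P → record { ⟦_⟧ = idᶠ ; isHom = id-isHom P }
        ; natural = λ {_} {P} _ _ → ≈ᴹ-refl P
        ; isoˡ    = λ P _ → ≈ᴹ-refl P
        ; isoʳ    = λ P _ → ≈ᴹ-refl P } } }
    where
    id-isHom : ∀ {K L : KleeneAlgebra _} (P : KleeneBimodule K L) → _
    id-isHom P = Identity.isBisemimoduleHomomorphism (rawBisemimodule P) (≈ᴹ-refl P)

module _ {A B : Semiring ℓ ℓ} {M : Bisemimodule A B ℓ ℓ} {N : Bisemimodule B A ℓ ℓ} where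
  private
    module A = Semiring A
    module M = Bisemimodule M
    module N = Bisemimodule N
    module M⊗N = Bisemimodule (M ⊗ N)
    module Mᵒᵖ = Bisemimodule (flipBi M)
    module Nᵒᵖ = Bisemimodule (flipBi N)
    module N⊗Mᵒᵖ = Bisemimodule (flipBi N ⊗ flipBi M)

    swap-sum : N⊗Mᵒᵖ.Carrierᴹ → M⊗N.Carrierᴹ
    swap-sum = extend M⊗N.+ᴹ-commutativeMonoid λ n m → [ m , n ]

    swap-sumᵒᵖ : M⊗N.Carrierᴹ → N⊗Mᵒᵖ.Carrierᴹ
    swap-sumᵒᵖ = extend N⊗Mᵒᵖ.+ᴹ-commutativeMonoid λ m n → [ n , m ]

    swap-sum-resp : ∀ {u v} → u N⊗Mᵒᵖ.≈ᴹ v → swap-sum u M⊗N.≈ᴹ swap-sum v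
    swap-sum-resp = extend-resp Nᵒᵖ.rightSemimodule Mᵒᵖ.leftSemimodule M⊗N.+ᴹ-commutativeMonoid
                      {λ n m → [ m , n ]} record
      { cong    = flip ⊗-cong
      ; addˡ    = λ n n′ m → ⊗-addʳ m n n′
      ; addʳ    = λ n m m′ → ⊗-addˡ m m′ n
      ; zeroˡ   = ⊗-zeroʳ
      ; zeroʳ   = ⊗-zeroˡ
      ; balance = λ n b m → ≋-sym (⊗-balance m b n) }

    swap-sumᵒᵖ-resp : ∀ {u v} → u M⊗N.≈ᴹ v → swap-sumᵒᵖ u N⊗Mᵒᵖ.≈ᴹ swap-sumᵒᵖ v
    swap-sumᵒᵖ-resp = extend-resp M.rightSemimodule N.leftSemimodule N⊗Mᵒᵖ.+ᴹ-commutativeMonoid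
                        {λ m n → [ n , m ]} record
      { cong    = flip ⊗-cong
      ; addˡ    = λ m m′ n → ⊗-addʳ n m m′
      ; addʳ    = λ m n n′ → ⊗-addˡ n n′ m
      ; zeroˡ   = ⊗-zeroʳ
      ; zeroʳ   = ⊗-zeroˡ
      ; balance = λ m b n → ≋-sym (⊗-balance n b m) }

    swap-sum-swap-sumᵒᵖ : ∀ u → swap-sum (swap-sumᵒᵖ u) M⊗N.≈ᴹ u
    swap-sum-swap-sumᵒᵖ [] = ≋-refl
    swap-sum-swap-sumᵒᵖ ((m , n) ∷ u) = ++-cong ≋-refl (swap-sum-swap-sumᵒᵖ u)

    swap-sumᵒᵖ-swap-sum : ∀ u → swap-sumᵒᵖ (swap-sum u) N⊗Mᵒᵖ.≈ᴹ u
    swap-sumᵒᵖ-swap-sum [] = ≋-refl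
    swap-sumᵒᵖ-swap-sum ((n , m) ∷ u) = ++-cong ≋-refl (swap-sumᵒᵖ-swap-sum u)

    swap-sum-*ₗ : ∀ a u → swap-sum (a N⊗Mᵒᵖ.*ₗ u) M⊗N.≈ᴹ swap-sum u M⊗N.*ᵣ a
    swap-sum-*ₗ a [] = ≋-refl
    swap-sum-*ₗ a ((n , m) ∷ u) = ++-cong ≋-refl (swap-sum-*ₗ a u)

    swap-sum-*ᵣ : ∀ u a → swap-sum (u N⊗Mᵒᵖ.*ᵣ a) M⊗N.≈ᴹ a M⊗N.*ₗ swap-sum u
    swap-sum-*ᵣ [] a = ≋-refl
    swap-sum-*ᵣ ((n , m) ∷ u) a = ++-cong ≋-refl (swap-sum-*ᵣ u a)

  -- Passing to opposites reverses the order of tensor factors: n ⊗ m ↦ m ⊗ n identifies the flipped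
  -- product with M ⊗ N and exchanges its left and right actions. Composing with φ lands in the
  -- opposite semiring.
  flip-⊗≅ : M ⊗ N ≅ tensorUnit {R = A} → flipBi N ⊗ flipBi M ≅ tensorUnit {R = Op.semiring A}
  flip-⊗≅ φ = (λ u → pair (swap-sum u)) , record
    { isBisemimoduleMonomorphism = record
      { isBisemimoduleHomomorphism = record
        { +ᴹ-isMonoidHomomorphism = record
          { isMagmaHomomorphism = record
            { isRelHomomorphism = record { cong = λ p → pair.⟦⟧-cong (swap-sum-resp p) }
            ; homo = λ u v → A.trans
                (pair.⟦⟧-cong (extend-++ M⊗N.+ᴹ-commutativeMonoid (λ n m → [ m , n ]) u v))
                (pair.+ᴹ-homo _ _) }
          ; ε-homo = pair.0ᴹ-homo }
        ; *ₗ-homo = λ a u → A.trans (pair.⟦⟧-cong (swap-sum-*ₗ a u)) (pair.*ᵣ-homo a _)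
        ; *ᵣ-homo = λ a u → A.trans (pair.⟦⟧-cong (swap-sum-*ᵣ u a)) (pair.*ₗ-homo a _) }
      ; injective = λ {u} {v} p → ≋-trans (≋-sym (swap-sumᵒᵖ-swap-sum u))
          (≋-trans (swap-sumᵒᵖ-resp (pair.injective p)) (swap-sumᵒᵖ-swap-sum v)) }
    ; surjective = λ a → let u , u↦a = pair.surjective a in
        swap-sumᵒᵖ u , λ p → u↦a (≋-trans (swap-sum-resp p) (swap-sum-swap-sumᵒᵖ u)) }
    where open Pairing M N φ

-- Tensoring with M and N

leftHom : {A B : Semiring ℓ ℓ} {P Q : Bisemimodule A B ℓ ℓ} → BiHom P Q →
          LeftHom (Bisemimodule.leftSemimodule P) (Bisemimodule.leftSemimodule Q)
leftHom f = record { isHom = BiHom.isLeftSemimoduleHomomorphism f }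

module _ (K S : KleeneAlgebra ℓ)
         (M : Bisemimodule (KleeneAlgebra.semiring K) (KleeneAlgebra.semiring S) ℓ ℓ)
         (N : Bisemimodule (KleeneAlgebra.semiring S) (KleeneAlgebra.semiring K) ℓ ℓ)
         (φ : M ⊗ N ≅ tensorUnit {R = KleeneAlgebra.semiring K})
         (ψ : N ⊗ M ≅ tensorUnit {R = KleeneAlgebra.semiring S}) where
  open LeftKleeneModule

  tensor-preservesLeftKleene : PreservesLeftKleene K S N
  tensor-preservesLeftKleene P =
    KleeneMorita.⊗ₗ-isLeftKleene K S M N φ ψ (leftSemimodule P) (isLeftKleene P)

module _ (K S : KleeneAlgebra ℓ)
         (M : Bisemimodule (KleeneAlgebra.semiring K) (KleeneAlgebra.semiring S) ℓ ℓ)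
         (N : Bisemimodule (KleeneAlgebra.semiring S) (KleeneAlgebra.semiring K) ℓ ℓ)
         (φ : M ⊗ N ≅ tensorUnit {R = KleeneAlgebra.semiring K}) where
  open LeftKleeneModule
  open Pairing M N φ
  open Evaluation

  tensorUnitIso : (kN : PreservesLeftKleene K S N) (kM : PreservesLeftKleene S K M) →
                  NaturalIsomorphism (idFunctor (LeftKleeneModules K))
                                     (tensorFunctor S K M kM ∘F tensorFunctor K S N kN)
  tensorUnitIso kN kM = record
    { η       = λ P → coevaluateHom (leftSemimodule P)
    ; η⁻¹     = λ P → evaluateHom (leftSemimodule P)
    ; natural = λ f → coevaluate-natural f
    ; isoˡ    = λ P → evaluate-coevaluate (leftSemimodule P)
    ; isoʳ    = λ P → coevaluate-evaluate (leftSemimodule P) }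

module _ (K S : KleeneAlgebra ℓ)
         (M : Bisemimodule (KleeneAlgebra.semiring K) (KleeneAlgebra.semiring S) ℓ ℓ)
         (N : Bisemimodule (KleeneAlgebra.semiring S) (KleeneAlgebra.semiring K) ℓ ℓ)
         (φ : M ⊗ N ≅ tensorUnit {R = KleeneAlgebra.semiring K})
         (ψ : N ⊗ M ≅ tensorUnit {R = KleeneAlgebra.semiring S}) where

  -- The unit comes from φ. With K and S, and M and N, exchanged, the same construction from ψ gives
  -- a unit for the reversed functors, whose inverse is the counit.
  tensor-isEquivalence : (kN : PreservesLeftKleene K S N) (kM : PreservesLeftKleene S K M) →
    IsEquivalenceOfCategories (tensorFunctor K S N kN) (tensorFunctor S K M kM)
  tensor-isEquivalence kN kM = record
    { unit   = tensorUnitIso K S M N φ kN kM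
    ; counit = naturalIso-sym (idFunctor (LeftKleeneModules S))
        (tensorFunctor K S N kN ∘F tensorFunctor S K M kM)
        (tensorUnitIso S K N M ψ kM kN) }

  leftKleeneModules-≃ : LeftKleeneModules K ≃ LeftKleeneModules S
  leftKleeneModules-≃ = record
    { to   = tensorFunctor K S N kN
    ; from = tensorFunctor S K M kM
    ; isEquivalence = tensor-isEquivalence kN kM }
    where
    kN : PreservesLeftKleene K S N
    kN = tensor-preservesLeftKleene K S M N φ ψ
    kM : PreservesLeftKleene S K M
    kM = tensor-preservesLeftKleene S K N M ψ φ

-- Tensoring Kleene bimodules on the left

module _ {A B C : Semiring ℓ ℓ} (X : Bisemimodule A B ℓ ℓ) {P Q : Bisemimodule B C ℓ ℓ} where
  private
    module X⊗P = Bisemimodule (X ⊗ P)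
    module X⊗Q = Bisemimodule (X ⊗ Q)

  infixl 7 _⊗₂_
  _⊗₂_ : BiHom P Q → BiHom (X ⊗ P) (X ⊗ Q)
  _⊗₂_ f = record
    { ⟦_⟧ = X⊗f.⟦_⟧
    ; isHom = record
      { +ᴹ-isMonoidHomomorphism = X⊗f.+ᴹ-isMonoidHomomorphism
      ; *ₗ-homo = X⊗f.*ₗ-homo
      ; *ᵣ-homo = scale } }
    where
    module f = BiHom f
    module X⊗f = LeftHom (X ⊗₁ leftHom f)
    scale : ∀ c u → X⊗f.⟦ u X⊗P.*ᵣ c ⟧ X⊗Q.≈ᴹ X⊗f.⟦ u ⟧ X⊗Q.*ᵣ c
    scale c [] = ≋-refl
    scale c ((x , p) ∷ u) =
      ++-cong (⊗-cong (Bisemimodule.≈ᴹ-refl X) (f.*ᵣ-homo c p)) (scale c u)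

module _ {A B C : Semiring ℓ ℓ} (X : Bisemimodule A B ℓ ℓ) where
  open BiHom
  private
    module X = Bisemimodule X
    _≋_ : {P : Bisemimodule B C ℓ ℓ} → (u v : Bisemimodule.Carrierᴹ (X ⊗ P)) → Set ℓ
    _≋_ {P} = Bisemimodule._≈ᴹ_ (X ⊗ P)

  ⊗₂-cong : (P Q : Bisemimodule B C ℓ ℓ) (f g : BiHom P Q) →
            (∀ p → Bisemimodule._≈ᴹ_ Q (⟦ f ⟧ p) (⟦ g ⟧ p)) →
            ∀ u → _≋_ {Q} (⟦ X ⊗₂ f ⟧ u) (⟦ X ⊗₂ g ⟧ u)
  ⊗₂-cong P Q f g eq []            = ≋-refl
  ⊗₂-cong P Q f g eq ((x , p) ∷ u) = ++-cong (⊗-cong X.≈ᴹ-refl (eq p)) (⊗₂-cong P Q f g eq u)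

  ⊗₂-id : (P : Bisemimodule B C ℓ ℓ) → ∀ u → _≋_ {P} (mapSum idᶠ idᶠ u) u
  ⊗₂-id P []      = ≋-refl
  ⊗₂-id P (_ ∷ u) = ++-cong ≋-refl (⊗₂-id P u)

  ⊗₂-∘ : (P Q R : Bisemimodule B C ℓ ℓ) (f : BiHom P Q) (g : BiHom Q R) →
         ∀ u → _≋_ {R} (mapSum idᶠ (λ p → ⟦ g ⟧ (⟦ f ⟧ p)) u) (⟦ X ⊗₂ g ⟧ (⟦ X ⊗₂ f ⟧ u))
  ⊗₂-∘ P Q R f g []      = ≋-refl
  ⊗₂-∘ P Q R f g (_ ∷ u) = ++-cong ≋-refl (⊗₂-∘ P Q R f g u)

module _ (K S L : KleeneAlgebra ℓ)
         (M : Bisemimodule (KleeneAlgebra.semiring K) (KleeneAlgebra.semiring S) ℓ ℓ)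
         (N : Bisemimodule (KleeneAlgebra.semiring S) (KleeneAlgebra.semiring K) ℓ ℓ)
         (φ : M ⊗ N ≅ tensorUnit {R = KleeneAlgebra.semiring K})
         (ψ : N ⊗ M ≅ tensorUnit {R = KleeneAlgebra.semiring S}) where
  open KleeneBimodule
  open BiHom

  private
    F₀ : KleeneBimodule K L → KleeneBimodule S L
    F₀ P = record
      { bisemimodule  = N ⊗ bisemimodule P
      ; isLeftKleene  = KleeneMorita.⊗ₗ-isLeftKleene K S M N φ ψ (leftSemimodule P) (isLeftKleene P)
      ; isRightKleene = KleeneMorita.⊗-isRightKleene K S M N φ ψ L (bisemimodule P)
                          (isRightKleene P) }

  bimoduleTensorFunctor : Functor (KleeneBimodules K L) (KleeneBimodules S L)
  bimoduleTensorFunctor = record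
    { F₀ = F₀
    ; F₁ = λ {P} {Q} f → _⊗₂_ N {bisemimodule P} {bisemimodule Q} f
    ; F-resp-≈     = λ {P} {Q} {f} {g} → ⊗₂-cong N (bisemimodule P) (bisemimodule Q) f g
    ; identity     = λ {P} → ⊗₂-id N (bisemimodule P)
    ; homomorphism = λ {P} {Q} {R} →
        ⊗₂-∘ N (bisemimodule P) (bisemimodule Q) (bisemimodule R) }

module _ (K S L : KleeneAlgebra ℓ)
         (M : Bisemimodule (KleeneAlgebra.semiring K) (KleeneAlgebra.semiring S) ℓ ℓ)
         (N : Bisemimodule (KleeneAlgebra.semiring S) (KleeneAlgebra.semiring K) ℓ ℓ)
         (φ : M ⊗ N ≅ tensorUnit {R = KleeneAlgebra.semiring K})
         (ψ : N ⊗ M ≅ tensorUnit {R = KleeneAlgebra.semiring S}) where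
  open KleeneBimodule
  open Pairing M N φ
  open Evaluation
  open BimoduleEvaluation

  bimoduleTensorUnitIso : NaturalIsomorphism (idFunctor (KleeneBimodules K L))
    (bimoduleTensorFunctor S K L N M ψ φ ∘F bimoduleTensorFunctor K S L M N φ ψ)
  bimoduleTensorUnitIso = record
    { η       = λ P → coevaluateBiHom (bisemimodule P)
    ; η⁻¹     = λ P → evaluateBiHom (bisemimodule P)
    ; natural = λ {P} {Q} f → coevaluate-natural {leftSemimodule P} {leftSemimodule Q} (leftHom f)
    ; isoˡ    = λ P → evaluate-coevaluate (leftSemimodule P)
    ; isoʳ    = λ P → coevaluate-evaluate (leftSemimodule P) }

module _ (K S L : KleeneAlgebra ℓ)
         (M : Bisemimodule (KleeneAlgebra.semiring K) (KleeneAlgebra.semiring S) ℓ ℓ)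
         (N : Bisemimodule (KleeneAlgebra.semiring S) (KleeneAlgebra.semiring K) ℓ ℓ)
         (φ : M ⊗ N ≅ tensorUnit {R = KleeneAlgebra.semiring K})
         (ψ : N ⊗ M ≅ tensorUnit {R = KleeneAlgebra.semiring S}) where

  -- The algebra L acting on the right is a parameter because the left side is changed in two
  -- settings: with L = S, and over the opposites with L = S ᵒᵖ.
  kleeneBimodulesˡ-≃ : KleeneBimodules K L ≃ KleeneBimodules S L
  kleeneBimodulesˡ-≃ = record
    { to   = N⊗
    ; from = M⊗
    ; isEquivalence = record
      { unit   = bimoduleTensorUnitIso K S L M N φ ψ
      ; counit = naturalIso-sym (idFunctor (KleeneBimodules S L)) (N⊗ ∘F M⊗)
          (bimoduleTensorUnitIso S K L N M ψ φ) } }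
    where
    N⊗ : Functor (KleeneBimodules K L) (KleeneBimodules S L)
    N⊗ = bimoduleTensorFunctor K S L M N φ ψ
    M⊗ : Functor (KleeneBimodules S L) (KleeneBimodules K L)
    M⊗ = bimoduleTensorFunctor S K L N M ψ φ

mainTheorem3 : ∀ {ℓ : Level} (K S : KleeneAlgebra ℓ) (M : KleeneBimodule K S) (N : KleeneBimodule S K) →
    KleeneBimodule.bisemimodule M ⊗ KleeneBimodule.bisemimodule N ≅ tensorUnit {R = KleeneAlgebra.semiring K} →
    KleeneBimodule.bisemimodule N ⊗ KleeneBimodule.bisemimodule M ≅ tensorUnit {R = KleeneAlgebra.semiring S} →
    (Σ[ kN ∈ PreservesLeftKleene K S (KleeneBimodule.bisemimodule N) ]
     Σ[ kM ∈ PreservesLeftKleene S K (KleeneBimodule.bisemimodule M) ]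
       IsEquivalenceOfCategories
         (tensorFunctor K S (KleeneBimodule.bisemimodule N) kN)
         (tensorFunctor S K (KleeneBimodule.bisemimodule M) kM))
    × (RightKleeneModules K ≃ RightKleeneModules S)
    × (KleeneBimodules K S ≃ KleeneBimodules S K)
mainTheorem3 K S 𝑀 𝑁 φ ψ =
    (kN , kM , tensor-isEquivalence K S M N φ ψ kN kM)
  -- Flipping exchanges the roles of M and N. Read without opposites, the functor amounts to P ↦ P
  -- ⊗_K M.
  , ≃-trans (right≃leftᵒᵖ K)
      (≃-trans (leftKleeneModules-≃ (K ᵒᵖ) (S ᵒᵖ) (flipBi N) (flipBi M) φᵒᵖ ψᵒᵖ)
               (≃-sym (right≃leftᵒᵖ S)))
  -- One side is changed at a time, through (S,S)-bimodules: first N ⊗_K P, then, over the opposite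
  -- algebras, tensoring with N on the other side. The composite amounts to P ↦ N ⊗_K P ⊗_S N.
  , ≃-trans (kleeneBimodulesˡ-≃ K S S M N φ ψ)
      (≃-trans (flipBimodules S S)
        (≃-trans (kleeneBimodulesˡ-≃ (S ᵒᵖ) (K ᵒᵖ) (S ᵒᵖ) (flipBi M) (flipBi N) ψᵒᵖ φᵒᵖ)
                 (≃-sym (flipBimodules S K))))
  where
  M = KleeneBimodule.bisemimodule 𝑀
  N = KleeneBimodule.bisemimodule 𝑁
  φᵒᵖ = flip-⊗≅ {M = M} {N} φ
  ψᵒᵖ = flip-⊗≅ {M = N} {M} ψ
  kN = tensor-preservesLeftKleene K S M N φ ψ
  kM = tensor-preservesLeftKleene S K N M ψ φ
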